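{- Let $\varepsilon>0$ and let $G$ be a graph on $V=L\cup R$ ($L,R$ disjoint) with $|V|\le n$. If one has to change (add or delete) at least $\varepsilon n^2$ edges of the bipartite graph $G[L,R]$ to make it $M_2$-free, then a set $X\subseteq V$ chosen uniformly at random among subsets of $V$ of size $\frac{4}{\varepsilon}\ln\frac1\varepsilon$ induces a bipartite graph $G[L\cap X,R\cap X]$ that contains an $M_2$ with probability at least $\tfrac12$.
   Context: $G[L,R]$ is the bipartite graph with parts $L,R$ whose edges are the edges of $G$ between $L$ and $R$; changes are only to pairs with one end in $L$ and one in $R$. An $M_2$ in $G[L,R]$ is a set of distinct vertices $\ell_1,\ell_2\in L$, $r_1,r_2\in R$ with $\ell_1r_1,\ell_2r_2$ edges and $\ell_1r_2,\ell_2r_1$ non-edges; $M_2$-free means containing no $M_2$.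
   Formalization: Here ε is a rational number rather than an arbitrary positive real; the size condition, for every integer size at least (4/ε)ln(1/ε), is expressed through partial sums of the exponential series. -}

module Defs where

open import Data.Nat as ℕ using (ℕ; zero; suc)
open import Data.Integer using (+_)
open import Data.Bool using (Bool; true; false)
open import Data.Fin using (Fin; zero; suc)
open import Data.Fin.Subset using (Subset; _∈_; ⊤)
open import Data.Product using (Σ; ∃; _×_; _,_)
open import Data.Empty using (⊥)
open import Relation.Nullary using (¬_)
open import Relation.Binary.PropositionalEquality using (_≡_; _≢_)
open import Data.Rational using (ℚ; _/_; _+_; _*_; _≤_; 1ℚ; 0ℚ)

record Graph (m : ℕ) : Set where
  field
    adj   : Fin m → Fin m → Bool
    sym   : ∀ i j → adj i j ≡ adj j i
    loopless : ∀ i → adj i i ≡ false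

-- A partition V = L ∪ R (disjoint): side i ≡ false means i ∈ L, side i ≡ true means i ∈ R.
Side : ℕ → Set
Side m = Fin m → Bool

-- The bipartite graph H[L ∩ X, R ∩ X] contains an M₂, where H is given by its
-- values on pairs (ℓ , r) with ℓ ∈ L and r ∈ R.
HasM₂ : ∀ {m} → Side m → Subset m → (Fin m → Fin m → Bool) → Set
HasM₂ {m} side X H =
  Σ (Fin m) λ l₁ → Σ (Fin m) λ l₂ → Σ (Fin m) λ r₁ → Σ (Fin m) λ r₂ →
    (l₁ ≢ l₂) × (r₁ ≢ r₂) ×
    (side l₁ ≡ false) × (side l₂ ≡ false) × (side r₁ ≡ true) × (side r₂ ≡ true) ×
    (l₁ ∈ X) × (l₂ ∈ X) × (r₁ ∈ X) × (r₂ ∈ X) ×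
    (H l₁ r₁ ≡ true) × (H l₂ r₂ ≡ true) × (H l₁ r₂ ≡ false) × (H l₂ r₁ ≡ false)

M₂Free : ∀ {m} → Side m → (Fin m → Fin m → Bool) → Set
M₂Free side H = ¬ HasM₂ side ⊤ H

sumFin : ∀ m → (Fin m → ℕ) → ℕ
sumFin zero    f = 0
sumFin (suc m) f = f zero ℕ.+ sumFin m (λ i → f (suc i))

differ : Bool → Bool → ℕ
differ true  false = 1
differ false true  = 1
differ _     _     = 0

pairLR : Bool → Bool → ℕ
pairLR false true = 1
pairLR _     _    = 0

dist : ∀ {m} → Side m → (Fin m → Fin m → Bool) → (Fin m → Fin m → Bool) → ℕ
dist {m} side G H =
  sumFin m λ i → sumFin m λ j → pairLR (side i) (side j) ℕ.* differ (G i j) (H i j)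

⟦_⟧ : ℕ → ℚ
⟦ k ⟧ = + k / 1

expTerm : ℚ → ℕ → ℚ
expTerm q zero    = 1ℚ
expTerm q (suc k) = expTerm q k * q * (+ 1 / suc k)

expPartial : ℚ → ℕ → ℚ
expPartial q zero    = 0ℚ
expPartial q (suc N) = expPartial q N + expTerm q N

-- s ≥ (4/ε) ln(1/ε)  ⇔  exp(ε s / 4) ≥ 1/ε  ⇔  ∃ N, 1 ≤ ε · Σ_{k<N} (εs/4)^k/k!   (for ε > 0)
SizeBound : ℚ → ℕ → Set
SizeBound ε s = ∃ λ N → 1ℚ ≤ ε * expPartial (ε * ⟦ s ⟧ * (+ 1 / 4)) N

{-# OPTIONS --safe #-}
module Submission where

-- Put d = ⌈εn⌉ and peel vertices off one at a time: a vertex of L with fewer than d non-neighbours among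
-- the remaining vertices of R is made complete to them, a vertex of R with fewer than d neighbours among
-- the remaining vertices of L is isolated from them. If all of L could be peeled, fewer than εn² changes
-- would give a threshold graph, which is M₂-free. So there is a nonempty core in which every l ∈ L has at
-- least d non-neighbours and every r ∈ R has at least d neighbours. Let l₀ be in L and in the core. If X
-- meets the non-neighbourhood of l₀ in the core, and the corresponding set of each vertex of X in the core,
-- then a vertex of L ∩ X in the core with the most neighbours in X has a non-neighbour r₂ ∈ X, which has a
-- neighbour l₂ ∈ X, and maximality yields an M₂.
--
-- By a union bound the proportion of bad sets X is at most (1 − ε)ˢ + s (1 − ε)ˢ⁻¹. Since deleting all
-- edges is also a way to become M₂-free, ε ≤ 1/4; with x = (1 − ε/4)ˢ the size bound gives x ≤ ε, while
-- (1 − ε)ˢ ≤ x⁴ and x · εs/4 ≤ 1, so that this proportion is at most 1/2.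

open import Defs
open import Data.Nat as ℕ using (ℕ; zero; suc)
import Data.Nat.Properties as ℕₚ
open import Data.Nat.Combinatorics using (_C_; nCk≡nC[n∸k]; nCn≡1; nCk+nC[k+1]≡[n+1]C[k+1]; k>n⇒nCk≡0)
import Data.Integer as ℤ
import Data.Integer.Properties as ℤₚ
import Data.Rational as ℚ
import Data.Rational.Properties as ℚₚ
import Data.Rational.Unnormalised as ℚᵘ
import Data.Rational.Unnormalised.Properties as ℚᵘₚ
open import Data.Rational.Solver using () renaming (module +-*-Solver to ℚ-Solver)
open import Data.Nat.Solver using () renaming (module +-*-Solver to ℕ-Solver)
open import Algebra.Bundles using (CommutativeRing)
open import Algebra.Properties.CommutativeSemigroup ℕₚ.+-commutativeSemigroup using (interchange)
open import Data.Bool as Bool using (Bool; true; false; not; _∧_; if_then_else_)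
import Data.Bool.Properties as Boolₚ
open import Data.Fin using (Fin; zero; suc)
import Data.Fin.Properties as Finₚ
open import Data.Fin.Subset using (Subset; inside; outside; ∣_∣)
open import Data.Vec using (lookup; []; _∷_)
open import Data.Vec.Properties using (lookup⇒[]=; ∷-injectiveʳ)
open import Data.List using (List; []; _∷_; _++_; map; filter; length)
import Data.List.Properties as Listₚ
open import Data.List.Membership.Propositional.Properties using (∈-map⁻)
open import Data.List.Relation.Unary.All as All using (All; []; _∷_)
import Data.List.Relation.Unary.All.Properties as Allₚ
open import Data.List.Relation.Unary.Unique.Propositional using (Unique; []; _∷_)
import Data.List.Relation.Unary.Unique.Propositional.Properties as Uniqueₚ
open import Data.Nat.ListAction using (sum)
open import Data.Nat.ListAction.Properties using (sum-++)
open import Data.Product using (∃; _×_; _,_; proj₂)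
open import Data.Sum using (_⊎_; inj₁; inj₂)
open import Data.Empty using (⊥; ⊥-elim)
open import Data.Unit using (tt)
open import Function using (_∘_)
open import Relation.Nullary using (¬_; yes; no; does; contradiction)
open import Relation.Nullary.Decidable using (_×-dec_; dec-true; toWitness)
open import Relation.Binary.PropositionalEquality

-- Binomial coefficients

nC0≡1 : ∀ n → n C 0 ≡ 1
nC0≡1 n = trans (nCk≡nC[n∸k] {0} {n} ℕ.z≤n) (nCn≡1 n)

-- Absorption. After one use of Pascal's rule a single copy of `X` is set aside; the two remaining
-- products are instances for n, and Pascal's rule reassembles them into `suc n` copies of `X`. It
-- later turns m · C(m-1, s-1), the shape of the union bound, into s · C(m, s).
[k+1]*[n+1]C[k+1] : ∀ n k → suc k ℕ.* (suc n C suc k) ≡ suc n ℕ.* (n C k)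
[k+1]*[n+1]C[k+1] zero    zero    = refl
[k+1]*[n+1]C[k+1] zero    (suc k) = trans (cong (suc (suc k) ℕ.*_) (k>n⇒nCk≡0 {1} {suc (suc k)} (ℕ.s≤s (ℕ.s≤s ℕ.z≤n))))
  (ℕₚ.*-zeroʳ (suc (suc k)))
[k+1]*[n+1]C[k+1] (suc n) zero    =
  trans (cong (1 ℕ.*_) (trans (sym (nCk+nC[k+1]≡[n+1]C[k+1] (suc n) 0))
    (cong₂ ℕ._+_ (nC0≡1 (suc n)) (trans (sym (ℕₚ.*-identityˡ (suc n C 1)))
      (trans ([k+1]*[n+1]C[k+1] n 0) (trans (cong (suc n ℕ.*_) (nC0≡1 n)) (ℕₚ.*-identityʳ (suc n))))))))
  (trans (ℕₚ.*-identityˡ (suc (suc n)))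
    (sym (trans (cong (suc (suc n) ℕ.*_) (nC0≡1 (suc n))) (ℕₚ.*-identityʳ (suc (suc n))))))
[k+1]*[n+1]C[k+1] (suc n) (suc k) = begin
  suc (suc k) ℕ.* (suc (suc n) C suc (suc k))
    ≡⟨ cong (suc (suc k) ℕ.*_) (sym (nCk+nC[k+1]≡[n+1]C[k+1] (suc n) (suc k))) ⟩
  suc (suc k) ℕ.* (X ℕ.+ Y)
    ≡⟨ ℕₚ.*-distribˡ-+ (suc (suc k)) X Y ⟩
  X ℕ.+ suc k ℕ.* X ℕ.+ suc (suc k) ℕ.* Y
    ≡⟨ cong₂ (λ u v → X ℕ.+ u ℕ.+ v) ([k+1]*[n+1]C[k+1] n k) ([k+1]*[n+1]C[k+1] n (suc k)) ⟩
  X ℕ.+ suc n ℕ.* (n C k) ℕ.+ suc n ℕ.* (n C suc k)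
    ≡⟨ trans (ℕₚ.+-assoc X _ _) (cong (X ℕ.+_) (sym (ℕₚ.*-distribˡ-+ (suc n) (n C k) (n C suc k)))) ⟩
  X ℕ.+ suc n ℕ.* (n C k ℕ.+ n C suc k)
    ≡⟨ cong (λ z → X ℕ.+ suc n ℕ.* z) (nCk+nC[k+1]≡[n+1]C[k+1] n k) ⟩
  suc (suc n) ℕ.* X ∎
  where
  open ≡-Reasoning
  X = suc n C suc k
  Y = suc n C suc (suc k)

-- Rational estimates

module RationalEstimates where

  open ℤ using (+_)
  open import Data.Rational
  open import Data.Rational.Properties
  open import Algebra.Properties.Semiring.Exp (CommutativeRing.semiring +-*-commutativeRing) using (_^_)
  open ℚ-Solver using (solve; _:=_; _:+_; _:*_; _:-_; con)

  -- The embedding of ℕ into ℚ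

  toℚᵘ-⟦⟧ : ∀ k → toℚᵘ ⟦ k ⟧ ℚᵘ.≃ (+ k ℚᵘ./ 1)
  toℚᵘ-⟦⟧ k = toℚᵘ-fromℚᵘ (+ k ℚᵘ./ 1)

  ⟦⟧-homo-+ : ∀ a b → ⟦ a ℕ.+ b ⟧ ≡ ⟦ a ⟧ + ⟦ b ⟧
  ⟦⟧-homo-+ a b = toℚᵘ-injective (begin
    toℚᵘ ⟦ a ℕ.+ b ⟧ ≈⟨ toℚᵘ-⟦⟧ (a ℕ.+ b) ⟩
    + (a ℕ.+ b) ℚᵘ./ 1 ≈⟨ ℚᵘ.*≡* (cong (ℤ._* + 1)
      (cong₂ ℤ._+_ (sym (ℤₚ.*-identityʳ (+ a))) (sym (ℤₚ.*-identityʳ (+ b))))) ⟩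
    (+ a ℚᵘ./ 1) ℚᵘ.+ (+ b ℚᵘ./ 1) ≈⟨ ℚᵘₚ.+-cong (toℚᵘ-⟦⟧ a) (toℚᵘ-⟦⟧ b) ⟨
    toℚᵘ ⟦ a ⟧ ℚᵘ.+ toℚᵘ ⟦ b ⟧ ≈⟨ toℚᵘ-homo-+ ⟦ a ⟧ ⟦ b ⟧ ⟨
    toℚᵘ (⟦ a ⟧ + ⟦ b ⟧) ∎)
    where open import Relation.Binary.Reasoning.Setoid ℚᵘₚ.≃-setoid

  ⟦⟧-homo-* : ∀ a b → ⟦ a ℕ.* b ⟧ ≡ ⟦ a ⟧ * ⟦ b ⟧
  ⟦⟧-homo-* a b = toℚᵘ-injective (begin
    toℚᵘ ⟦ a ℕ.* b ⟧ ≈⟨ toℚᵘ-⟦⟧ (a ℕ.* b) ⟩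
    + (a ℕ.* b) ℚᵘ./ 1 ≈⟨ ℚᵘ.*≡* (cong (ℤ._* + 1) (ℤₚ.pos-* a b)) ⟩
    (+ a ℚᵘ./ 1) ℚᵘ.* (+ b ℚᵘ./ 1) ≈⟨ ℚᵘₚ.*-cong (toℚᵘ-⟦⟧ a) (toℚᵘ-⟦⟧ b) ⟨
    toℚᵘ ⟦ a ⟧ ℚᵘ.* toℚᵘ ⟦ b ⟧ ≈⟨ toℚᵘ-homo-* ⟦ a ⟧ ⟦ b ⟧ ⟨
    toℚᵘ (⟦ a ⟧ * ⟦ b ⟧) ∎)
    where open import Relation.Binary.Reasoning.Setoid ℚᵘₚ.≃-setoid

  suc*recip≡1 : ∀ k → ⟦ suc k ⟧ * (+ 1 / suc k) ≡ 1ℚ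
  suc*recip≡1 k = toℚᵘ-injective (begin
    toℚᵘ (⟦ suc k ⟧ * (+ 1 / suc k)) ≈⟨ toℚᵘ-homo-* ⟦ suc k ⟧ (+ 1 / suc k) ⟩
    toℚᵘ ⟦ suc k ⟧ ℚᵘ.* toℚᵘ (+ 1 / suc k) ≈⟨ ℚᵘₚ.*-cong (toℚᵘ-⟦⟧ (suc k)) (toℚᵘ-fromℚᵘ (+ 1 ℚᵘ./ suc k)) ⟩
    (+ suc k ℚᵘ./ 1) ℚᵘ.* (+ 1 ℚᵘ./ suc k) ≈⟨ ℚᵘ.*≡* (cong (+_ ∘ suc) (trans (ℕₚ.*-identityʳ _)
      (trans (ℕₚ.*-identityʳ k) (sym (trans (ℕₚ.+-identityʳ _) (ℕₚ.+-identityʳ k)))))) ⟩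
    ℚᵘ.1ℚᵘ ∎)
    where open import Relation.Binary.Reasoning.Setoid ℚᵘₚ.≃-setoid

  ⟦⟧-mono : ∀ {a b} → a ℕ.≤ b → ⟦ a ⟧ ≤ ⟦ b ⟧
  ⟦⟧-mono {a} {b} a≤b = toℚᵘ-cancel-≤ (ℚᵘₚ.≤-trans (ℚᵘₚ.≤-reflexive (toℚᵘ-⟦⟧ a))
    (ℚᵘₚ.≤-trans (ℚᵘ.*≤* (ℤₚ.*-monoʳ-≤-nonNeg (+ 1) (ℤ.+≤+ a≤b))) (ℚᵘₚ.≤-reflexive (ℚᵘₚ.≃-sym (toℚᵘ-⟦⟧ b)))))

  ⟦⟧-cancel : ∀ {a b} → ⟦ a ⟧ ≤ ⟦ b ⟧ → a ℕ.≤ b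
  ⟦⟧-cancel {a} {b} le with ℚᵘₚ.≤-trans (ℚᵘₚ.≤-reflexive (ℚᵘₚ.≃-sym (toℚᵘ-⟦⟧ a)))
    (ℚᵘₚ.≤-trans (toℚᵘ-mono-≤ le) (ℚᵘₚ.≤-reflexive (toℚᵘ-⟦⟧ b)))
  ... | ℚᵘ.*≤* p = ℤₚ.drop‿+≤+ (subst₂ ℤ._≤_ (ℤₚ.*-identityʳ (+ a)) (ℤₚ.*-identityʳ (+ b)) p)

  0≤⟦⟧ : ∀ k → 0ℚ ≤ ⟦ k ⟧
  0≤⟦⟧ k = ⟦⟧-mono {0} {k} ℕ.z≤n

  open ≤-Reasoning

  0≤* : ∀ {a b} → 0ℚ ≤ a → 0ℚ ≤ b → 0ℚ ≤ a * b
  0≤* {a} {b} 0≤a 0≤b =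
    nonNegative⁻¹ _ {{nonNeg*nonNeg⇒nonNeg a {{nonNegative 0≤a}} b {{nonNegative 0≤b}}}}

  *-monoˡ : ∀ {a b c} → 0ℚ ≤ c → a ≤ b → c * a ≤ c * b
  *-monoˡ {c = c} 0≤c = *-monoˡ-≤-nonNeg c {{nonNegative 0≤c}}

  *-monoʳ : ∀ {a b c} → 0ℚ ≤ c → a ≤ b → a * c ≤ b * c
  *-monoʳ {c = c} 0≤c = *-monoʳ-≤-nonNeg c {{nonNegative 0≤c}}

  *-mono : ∀ {a b c d} → 0ℚ ≤ a → 0ℚ ≤ d → a ≤ b → c ≤ d → a * c ≤ b * d
  *-mono 0≤a 0≤d a≤b c≤d = ≤-trans (*-monoˡ 0≤a c≤d) (*-monoʳ 0≤d a≤b)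

  ≤-byDiff : ∀ {a b} c → 0ℚ ≤ c → a + c ≡ b → a ≤ b
  ≤-byDiff {a} c 0≤c refl = subst (_≤ a + c) (+-identityʳ a) (+-monoʳ-≤ a 0≤c)

  0≤^ : ∀ {a} n → 0ℚ ≤ a → 0ℚ ≤ a ^ n
  0≤^ zero    0≤a = nonNegative⁻¹ 1ℚ
  0≤^ (suc n) 0≤a = 0≤* 0≤a (0≤^ n 0≤a)

  0≤recip : ∀ k → 0ℚ ≤ + 1 / suc k
  0≤recip k = nonNegative⁻¹ _ {{normalize-nonNeg 1 (suc k)}}

  -- Truncated exponential series

  0≤expTerm : ∀ {q} k → 0ℚ ≤ q → 0ℚ ≤ expTerm q k
  0≤expTerm zero    0≤q = nonNegative⁻¹ 1ℚ
  0≤expTerm (suc k) 0≤q = 0≤* (0≤* (0≤expTerm k 0≤q) 0≤q) (0≤recip k)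

  suc-expTerm : ∀ q k → ⟦ suc k ⟧ * expTerm q (suc k) ≡ expTerm q k * q
  suc-expTerm q k = begin-equality
    ⟦ suc k ⟧ * (expTerm q k * q * (+ 1 / suc k))
      ≡⟨ solve 3 (λ n t c → n :* (t :* c) := n :* c :* t) refl ⟦ suc k ⟧ (expTerm q k * q) (+ 1 / suc k) ⟩
    ⟦ suc k ⟧ * (+ 1 / suc k) * (expTerm q k * q) ≡⟨ cong (_* (expTerm q k * q)) (suc*recip≡1 k) ⟩
    1ℚ * (expTerm q k * q) ≡⟨ *-identityˡ _ ⟩
    expTerm q k * q ∎

  -- A discrete form of convexity: (b+δ)ᵏ⁺¹ − bᵏ⁺¹ ≤ δ (k+1) (b+δ)ᵏ.
  expTerm-step : ∀ {b δ} → 0ℚ ≤ b → 0ℚ ≤ δ → ∀ k →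
    expTerm (b + δ) (suc k) ≤ expTerm b (suc k) + δ * expTerm (b + δ) k
  expTerm-step {b} {δ} 0≤b 0≤δ zero = ≤-reflexive
    (solve 2 (λ b δ → con 1ℚ :* (b :+ δ) :* con 1ℚ := con 1ℚ :* b :* con 1ℚ :+ δ :* con 1ℚ) refl b δ)
  expTerm-step {b} {δ} 0≤b 0≤δ (suc k) = begin
    t₁ * a * c
      ≡⟨ solve 4 (λ t b δ c → t :* (b :+ δ) :* c := t :* (b :* c) :+ δ :* (t :* c)) refl t₁ b δ c ⟩
    t₁ * (b * c) + δ * (t₁ * c)
      ≤⟨ +-monoˡ-≤ _ (*-monoʳ (0≤* 0≤b 0≤c) (expTerm-step 0≤b 0≤δ k)) ⟩
    (u₁ + δ * t₀) * (b * c) + δ * (t₁ * c)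
      ≡⟨ solve 6 (λ t₀ t₁ u₁ b δ c → (u₁ :+ δ :* t₀) :* (b :* c) :+ δ :* (t₁ :* c)
           := u₁ :* b :* c :+ δ :* c :* (t₀ :* b :+ t₁)) refl t₀ t₁ u₁ b δ c ⟩
    u₁ * b * c + δ * c * (t₀ * b + t₁)
      ≤⟨ +-monoʳ-≤ (u₁ * b * c) (*-monoˡ (0≤* 0≤δ 0≤c) (+-monoˡ-≤ t₁ (*-monoˡ 0≤t₀ b≤a))) ⟩
    u₁ * b * c + δ * c * (t₀ * a + t₁)
      ≡⟨ cong (λ z → u₁ * b * c + δ * c * (z + t₁)) (sym (suc-expTerm a k)) ⟩
    u₁ * b * c + δ * c * (⟦ suc k ⟧ * t₁ + t₁)
      ≡⟨ solve 5 (λ w δ c n t → w :+ δ :* c :* (n :* t :+ t) := w :+ δ :* ((con 1ℚ :+ n) :* c :* t))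
           refl (u₁ * b * c) δ c ⟦ suc k ⟧ t₁ ⟩
    u₁ * b * c + δ * ((1ℚ + ⟦ suc k ⟧) * c * t₁)
      ≡⟨ cong (λ z → u₁ * b * c + δ * (z * c * t₁)) (sym (⟦⟧-homo-+ 1 (suc k))) ⟩
    u₁ * b * c + δ * (⟦ suc (suc k) ⟧ * c * t₁)
      ≡⟨ cong (λ z → u₁ * b * c + δ * z) (trans (cong (_* t₁) (suc*recip≡1 (suc k))) (*-identityˡ t₁)) ⟩
    u₁ * b * c + δ * t₁ ∎
    where
    a = b + δ
    c = + 1 / suc (suc k)
    t₀ = expTerm a k
    t₁ = expTerm a (suc k)
    u₁ = expTerm b (suc k)
    0≤c = 0≤recip (suc k)
    b≤a : b ≤ a
    b≤a = ≤-byDiff δ 0≤δ refl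
    0≤t₀ = 0≤expTerm k (≤-trans 0≤b b≤a)

  -- `expTerm-step` summed over the nonconstant terms. The constant term does not depend on the
  -- argument, which is why the sum weighted by δ is one term shorter.
  expPartial-step : ∀ {b δ} → 0ℚ ≤ b → 0ℚ ≤ δ → ∀ N →
    expPartial (b + δ) (suc N) ≤ expPartial b (suc N) + δ * expPartial (b + δ) N
  expPartial-step {b} {δ} 0≤b 0≤δ zero = ≤-reflexive
    (solve 1 (λ δ → con 0ℚ :+ con 1ℚ := con 0ℚ :+ con 1ℚ :+ δ :* con 0ℚ) refl δ)
  expPartial-step {b} {δ} 0≤b 0≤δ (suc N) = begin
    expPartial (b + δ) (suc N) + expTerm (b + δ) (suc N)
      ≤⟨ +-mono-≤ (expPartial-step 0≤b 0≤δ N) (expTerm-step 0≤b 0≤δ N) ⟩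
    (P + δ * Q) + (T + δ * U)
      ≡⟨ solve 5 (λ P Q T U δ → (P :+ δ :* Q) :+ (T :+ δ :* U) := (P :+ T) :+ δ :* (Q :+ U)) refl P Q T U δ ⟩
    (P + T) + δ * (Q + U) ∎
    where
    P = expPartial b (suc N)
    Q = expPartial (b + δ) N
    T = expTerm b (suc N)
    U = expTerm (b + δ) N

  -- The counterpart of (1 - δ) e^(b+δ) ≤ e^b with the same truncation on both sides, so that it can
  -- be iterated. Passing from `suc N` terms to N in the δ-part of `expPartial-step` leaves exactly
  -- the nonnegative slack `δ * U`.
  expPartial-decay : ∀ {b δ} → 0ℚ ≤ b → 0ℚ ≤ δ → ∀ N →
    (1ℚ - δ) * expPartial (b + δ) N ≤ expPartial b N
  expPartial-decay {b} {δ} 0≤b 0≤δ zero = ≤-reflexive (*-zeroʳ (1ℚ - δ))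
  expPartial-decay {b} {δ} 0≤b 0≤δ (suc N) = begin
    (1ℚ - δ) * (Q + U)
      ≡⟨ solve 3 (λ δ Q U → (con 1ℚ :- δ) :* (Q :+ U) := (Q :+ U) :+ (con 0ℚ :- δ :* (Q :+ U))) refl δ Q U ⟩
    (Q + U) + (0ℚ - δ * (Q + U))
      ≤⟨ +-monoˡ-≤ (0ℚ - δ * (Q + U)) (expPartial-step 0≤b 0≤δ N) ⟩
    (P + δ * Q) + (0ℚ - δ * (Q + U))
      ≤⟨ ≤-byDiff (δ * U) (0≤* 0≤δ (0≤expTerm N (+-mono-≤ 0≤b 0≤δ)))
          (solve 4 (λ P Q U δ → (P :+ δ :* Q) :+ (con 0ℚ :- δ :* (Q :+ U)) :+ δ :* U := P) refl P Q U δ) ⟩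
    P ∎
    where
    P = expPartial b (suc N)
    Q = expPartial (b + δ) N
    U = expTerm (b + δ) N

  expTerm-0 : ∀ k → expTerm 0ℚ (suc k) ≡ 0ℚ
  expTerm-0 k = trans (cong (_* (+ 1 / suc k)) (*-zeroʳ (expTerm 0ℚ k))) (*-zeroˡ (+ 1 / suc k))

  expPartial-0 : ∀ N → expPartial 0ℚ (suc N) ≡ 1ℚ
  expPartial-0 zero    = refl
  expPartial-0 (suc N) = cong₂ _+_ (expPartial-0 N) (expTerm-0 N)

  expPartial-0≤1 : ∀ N → expPartial 0ℚ N ≤ 1ℚ
  expPartial-0≤1 zero    = nonNegative⁻¹ 1ℚ
  expPartial-0≤1 (suc N) = ≤-reflexive (expPartial-0 N)

  -- Stands in for (1 - δ)^s ≤ e^(-δs) without real exponentials: each factor 1 - δ lowers the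
  -- argument by δ, until the series is evaluated at 0.
  ^*expPartial≤1 : ∀ {δ} → 0ℚ ≤ δ → δ ≤ 1ℚ → ∀ N s →
    (1ℚ - δ) ^ s * expPartial (δ * ⟦ s ⟧) N ≤ 1ℚ
  ^*expPartial≤1 {δ} 0≤δ δ≤1 N zero = begin
    1ℚ * expPartial (δ * 0ℚ) N ≡⟨ *-identityˡ _ ⟩
    expPartial (δ * 0ℚ) N      ≡⟨ cong (λ z → expPartial z N) (*-zeroʳ δ) ⟩
    expPartial 0ℚ N            ≤⟨ expPartial-0≤1 N ⟩
    1ℚ ∎
  ^*expPartial≤1 {δ} 0≤δ δ≤1 N (suc s) = begin
    (1ℚ - δ) * p * expPartial (δ * ⟦ suc s ⟧) N
      ≡⟨ cong (λ z → (1ℚ - δ) * p * expPartial z N) eq ⟩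
    (1ℚ - δ) * p * expPartial (δ * ⟦ s ⟧ + δ) N
      ≡⟨ solve 3 (λ r p e → r :* p :* e := p :* (r :* e)) refl (1ℚ - δ) p (expPartial (δ * ⟦ s ⟧ + δ) N) ⟩
    p * ((1ℚ - δ) * expPartial (δ * ⟦ s ⟧ + δ) N)
      ≤⟨ *-monoˡ (0≤^ s 0≤1-δ) (expPartial-decay (0≤* 0≤δ (0≤⟦⟧ s)) 0≤δ N) ⟩
    p * expPartial (δ * ⟦ s ⟧) N
      ≤⟨ ^*expPartial≤1 0≤δ δ≤1 N s ⟩
    1ℚ ∎
    where
    p = (1ℚ - δ) ^ s
    0≤1-δ : 0ℚ ≤ 1ℚ - δ
    0≤1-δ = subst (_≤ 1ℚ - δ) (+-inverseʳ δ) (+-monoˡ-≤ (- δ) δ≤1)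
    eq : δ * ⟦ suc s ⟧ ≡ δ * ⟦ s ⟧ + δ
    eq = trans (cong (δ *_) (⟦⟧-homo-+ 1 s))
      (solve 2 (λ δ s → δ :* (con 1ℚ :+ s) := δ :* s :+ δ) refl δ ⟦ s ⟧)

  -- Ratios of binomial coefficients

  ⟦⟧-positive : ∀ {k} → 1 ℕ.≤ k → Positive ⟦ k ⟧
  ⟦⟧-positive {suc k} _ = normalize-pos (suc k) 1

  -- The ratio of the binomial coefficients is the product of (b - i)/(m - i) over i < s, and each
  -- factor is at most 1 - d/(m - i) ≤ 1 - ε. In the induction b and m drop together while d stays,
  -- so both hypotheses survive; absorption peels off one factor.
  C-ratio : ∀ {ε b d m} → 0ℚ ≤ 1ℚ - ε → 0ℚ ≤ ε → b ℕ.+ d ℕ.≤ m → ε * ⟦ m ⟧ ≤ ⟦ d ⟧ → ∀ s →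
    ⟦ b C s ⟧ ≤ (1ℚ - ε) ^ s * ⟦ m C s ⟧
  C-ratio {b = b} {m = m} 0≤r 0≤ε _ _ zero = ≤-reflexive
    (trans (cong ⟦_⟧ (nC0≡1 b)) (sym (trans (*-identityˡ ⟦ m C 0 ⟧) (cong ⟦_⟧ (nC0≡1 m)))))
  C-ratio {ε} {zero} {m = m} 0≤r 0≤ε _ _ (suc s) =
    subst (_≤ (1ℚ - ε) ^ suc s * ⟦ m C suc s ⟧) (cong ⟦_⟧ (sym (k>n⇒nCk≡0 {0} {suc s} (ℕ.s≤s ℕ.z≤n))))
      (0≤* (0≤^ (suc s) 0≤r) (0≤⟦⟧ (m C suc s)))
  C-ratio {ε} {suc b} {d} {suc m} 0≤r 0≤ε (ℕ.s≤s b+d≤m) εm≤d (suc s) =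
    *-cancelˡ-≤-pos ⟦ suc s ⟧ {{⟦⟧-positive {suc s} (ℕ.s≤s ℕ.z≤n)}} (begin
      ⟦ suc s ⟧ * ⟦ suc b C suc s ⟧         ≡⟨ ⟦⟧-homo-* (suc s) (suc b C suc s) ⟨
      ⟦ suc s ℕ.* (suc b C suc s) ⟧         ≡⟨ cong ⟦_⟧ ([k+1]*[n+1]C[k+1] b s) ⟩
      ⟦ suc b ℕ.* (b C s) ⟧                 ≡⟨ ⟦⟧-homo-* (suc b) (b C s) ⟩
      ⟦ suc b ⟧ * ⟦ b C s ⟧
        ≤⟨ *-mono (0≤⟦⟧ (suc b)) (0≤* (0≤^ s 0≤r) (0≤⟦⟧ (m C s))) b≤rm (C-ratio {b = b} {m = m} 0≤r 0≤ε b+d≤m εm'≤d s) ⟩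
      r * ⟦ suc m ⟧ * (r ^ s * ⟦ m C s ⟧)
        ≡⟨ solve 4 (λ r m p c → r :* m :* (p :* c) := r :* p :* (m :* c)) refl r ⟦ suc m ⟧ (r ^ s) ⟦ m C s ⟧ ⟩
      r * r ^ s * (⟦ suc m ⟧ * ⟦ m C s ⟧)
        ≡⟨ cong (r * r ^ s *_) (trans (sym (⟦⟧-homo-* (suc m) (m C s)))
             (trans (cong ⟦_⟧ (sym ([k+1]*[n+1]C[k+1] m s))) (⟦⟧-homo-* (suc s) (suc m C suc s)))) ⟩
      r * r ^ s * (⟦ suc s ⟧ * ⟦ suc m C suc s ⟧)
        ≡⟨ solve 3 (λ p k c → p :* (k :* c) := k :* (p :* c)) refl (r * r ^ s) ⟦ suc s ⟧ ⟦ suc m C suc s ⟧ ⟩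
      ⟦ suc s ⟧ * (r * r ^ s * ⟦ suc m C suc s ⟧) ∎)
    where
    r = 1ℚ - ε
    εm'≤d : ε * ⟦ m ⟧ ≤ ⟦ d ⟧
    εm'≤d = ≤-trans (*-monoˡ 0≤ε (⟦⟧-mono {m} {suc m} (ℕₚ.n≤1+n m))) εm≤d
    b≤rm : ⟦ suc b ⟧ ≤ r * ⟦ suc m ⟧
    b≤rm = begin
      ⟦ suc b ⟧ ≡⟨ solve 2 (λ x y → x := (x :+ y) :- y) refl ⟦ suc b ⟧ ⟦ d ⟧ ⟩
      (⟦ suc b ⟧ + ⟦ d ⟧) - ⟦ d ⟧
        ≤⟨ +-mono-≤ (subst (_≤ ⟦ suc m ⟧) (⟦⟧-homo-+ (suc b) d) (⟦⟧-mono {suc b ℕ.+ d} {suc m} (ℕ.s≤s b+d≤m)))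
             (neg-antimono-≤ εm≤d) ⟩
      ⟦ suc m ⟧ - ε * ⟦ suc m ⟧ ≡⟨ solve 2 (λ ε m → m :- ε :* m := (con 1ℚ :- ε) :* m) refl ε ⟦ suc m ⟧ ⟩
      r * ⟦ suc m ⟧ ∎

  -- Numerical consequences of the size bound

  ¼ : ℚ
  ¼ = + 1 / 4

  module SizeBound-consequences (ε : ℚ) (0<ε : 0ℚ < ε) (ε≤¼ : ε ≤ ¼) (s : ℕ) (size : SizeBound ε s) where

    q x : ℚ
    q = ε * ¼
    x = (1ℚ - q) ^ s

    0≤ε : 0ℚ ≤ ε
    0≤ε = <⇒≤ 0<ε

    0≤q : 0ℚ ≤ q
    0≤q = 0≤* 0≤ε (nonNegative⁻¹ ¼)

    q≤1/16 : q ≤ + 1 / 16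
    q≤1/16 = *-monoʳ (nonNegative⁻¹ ¼) ε≤¼

    q≤1 : q ≤ 1ℚ
    q≤1 = ≤-trans q≤1/16 (toWitness {a? = + 1 / 16 ≤? 1ℚ} _)

    0≤1-ε : 0ℚ ≤ 1ℚ - ε
    0≤1-ε = ≤-trans (toWitness {a? = 0ℚ ≤? 1ℚ - ¼} _) (+-monoʳ-≤ 1ℚ (neg-antimono-≤ ε≤¼))

    0≤1-q : 0ℚ ≤ 1ℚ - q
    0≤1-q = ≤-trans (toWitness {a? = 0ℚ ≤? 1ℚ - (+ 1 / 16)} _) (+-monoʳ-≤ 1ℚ (neg-antimono-≤ q≤1/16))

    0≤x : 0ℚ ≤ x
    0≤x = 0≤^ s 0≤1-q

    -- The size bound says 1 ≤ ε · P for a truncated exponential P at qs. Multiplied by x it gives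
    -- the claim, since x · P ≤ 1.
    x≤ε : x ≤ ε
    x≤ε = let N , le = size ; P = expPartial (q * ⟦ s ⟧) N in begin
      x       ≡⟨ *-identityʳ x ⟨
      x * 1ℚ  ≤⟨ *-monoˡ 0≤x le ⟩
      x * (ε * expPartial (ε * ⟦ s ⟧ * ¼) N)
        ≡⟨ cong (λ z → x * (ε * expPartial z N)) (solve 3 (λ ε s q → ε :* s :* q := ε :* q :* s) refl ε ⟦ s ⟧ ¼) ⟩
      x * (ε * P) ≡⟨ solve 3 (λ x ε P → x :* (ε :* P) := ε :* (x :* P)) refl x ε P ⟩
      ε * (x * P) ≤⟨ *-monoˡ 0≤ε (^*expPartial≤1 0≤q q≤1 N s) ⟩
      ε * 1ℚ      ≡⟨ *-identityʳ ε ⟩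
      ε ∎

    x≤¼ : x ≤ ¼
    x≤¼ = ≤-trans x≤ε ε≤¼

    x*q*s≤1 : x * (q * ⟦ s ⟧) ≤ 1ℚ
    x*q*s≤1 = begin
      -- Truncated after two terms the series is 1 + qs, so the difference of the two sides is x.
      x * (q * ⟦ s ⟧) ≤⟨ ≤-byDiff x 0≤x
        (solve 2 (λ x v → x :* v :+ x := x :* ((con 0ℚ :+ con 1ℚ) :+ con 1ℚ :* v :* con 1ℚ)) refl x (q * ⟦ s ⟧)) ⟩
      x * expPartial (q * ⟦ s ⟧) 2 ≤⟨ ^*expPartial≤1 0≤q q≤1 2 s ⟩
      1ℚ ∎

    -- One factor x is traded for ε = 4q; the other one absorbs qs.
    x*x*s≤4 : x * x * ⟦ s ⟧ ≤ + 4 / 1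
    x*x*s≤4 = begin
      x * x * ⟦ s ⟧  ≡⟨ *-assoc x x ⟦ s ⟧ ⟩
      x * (x * ⟦ s ⟧) ≤⟨ *-monoʳ (0≤* 0≤x (0≤⟦⟧ s)) x≤ε ⟩
      ε * (x * ⟦ s ⟧)
        ≡⟨ solve 3 (λ ε x s → ε :* (x :* s) := con (+ 4 / 1) :* (x :* (ε :* con ¼ :* s))) refl ε x ⟦ s ⟧ ⟩
      (+ 4 / 1) * (x * (q * ⟦ s ⟧)) ≤⟨ *-monoˡ (nonNegative⁻¹ (+ 4 / 1)) x*q*s≤1 ⟩
      + 4 / 1 ∎

    -- Bernoulli's inequality for ε = 4q, with the explicit difference q²(6 - 4q + q²); q ≤ 1/16
    -- keeps the bracket nonnegative.
    1-ε≤[1-q]⁴ : 1ℚ - ε ≤ (1ℚ - q) * (1ℚ - q) * ((1ℚ - q) * (1ℚ - q))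
    1-ε≤[1-q]⁴ = ≤-byDiff (q * q * (+ 6 / 1 - (+ 4 / 1) * q + q * q))
      (0≤* (0≤* 0≤q 0≤q) (+-mono-≤ (≤-trans (toWitness {a? = 0ℚ ≤? + 6 / 1 - (+ 4 / 1) * (+ 1 / 16)} _)
          (+-monoʳ-≤ (+ 6 / 1) (neg-antimono-≤ (*-monoˡ (nonNegative⁻¹ (+ 4 / 1)) q≤1/16)))) (0≤* 0≤q 0≤q)))
      (solve 1 (λ ε → let q = ε :* con ¼ ; p = con 1ℚ :- q in
        con 1ℚ :- ε :+ q :* q :* (con (+ 6 / 1) :- con (+ 4 / 1) :* q :+ q :* q) := p :* p :* (p :* p)) refl ε)

    [1-ε]^≤^⁴ : ∀ k → let y = (1ℚ - q) ^ k in (1ℚ - ε) ^ k ≤ y * y * (y * y)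
    [1-ε]^≤^⁴ zero    = ≤-refl
    [1-ε]^≤^⁴ (suc k) = begin
      (1ℚ - ε) * (1ℚ - ε) ^ k
        ≤⟨ *-mono 0≤1-ε (0≤* 0≤yy 0≤yy) 1-ε≤[1-q]⁴ ([1-ε]^≤^⁴ k) ⟩
      (p * p * (p * p)) * (y * y * (y * y))
        ≡⟨ solve 2 (λ p y → (p :* p :* (p :* p)) :* (y :* y :* (y :* y)) := (p :* y) :* (p :* y) :* ((p :* y) :* (p :* y))) refl p y ⟩
      (p * y) * (p * y) * ((p * y) * (p * y)) ∎
      where
      p = 1ℚ - q
      y = (1ℚ - q) ^ k
      0≤yy = 0≤* (0≤^ k 0≤1-q) (0≤^ k 0≤1-q)

  -- The first summand is the weight of missing the conflicts of one fixed vertex. The second is for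
  -- the sampled vertices missing their own conflicts: each such vertex uses up one element of the
  -- sample, which leaves the exponent s.
  failure-weight : ∀ ε → 0ℚ < ε → ε ≤ ¼ → ∀ s → SizeBound ε (suc s) →
    ((1ℚ - ε) ^ suc s + ⟦ suc s ⟧ * (1ℚ - ε) ^ s) + ((1ℚ - ε) ^ suc s + ⟦ suc s ⟧ * (1ℚ - ε) ^ s) ≤ 1ℚ
  failure-weight ε 0<ε ε≤¼ s size = begin
    Z + Z ≤⟨ +-mono-≤ Z≤½ Z≤½ ⟩
    1ℚ ∎
    where
    open SizeBound-consequences ε 0<ε ε≤¼ (suc s) size
    r = 1ℚ - ε
    k = ⟦ suc s ⟧
    t = r ^ s
    Z = r * t + k * t
    X = x * x
    0≤t = 0≤^ s 0≤1-ε
    0≤rt = 0≤* 0≤1-ε 0≤t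
    0≤Z : 0ℚ ≤ Z
    0≤Z = +-mono-≤ 0≤rt (0≤* (0≤⟦⟧ (suc s)) 0≤t)
    X≤ : X ≤ + 1 / 16
    X≤ = *-mono 0≤x (nonNegative⁻¹ ¼) x≤¼ x≤¼
    0≤X = 0≤* 0≤x 0≤x
    rt[1+k]≤ : r * t * (1ℚ + k) ≤ + 65 / 256
    rt[1+k]≤ = begin
      r * t * (1ℚ + k) ≤⟨ *-monoʳ (+-mono-≤ (nonNegative⁻¹ 1ℚ) (0≤⟦⟧ (suc s))) ([1-ε]^≤^⁴ (suc s)) ⟩
      X * X * (1ℚ + k) ≡⟨ solve 2 (λ X k → X :* X :* (con 1ℚ :+ k) := X :* X :+ X :* (X :* k)) refl X k ⟩
      X * X + X * (X * k)
        -- X ≤ 1/16 and X · k ≤ 4 give 1/256 + 1/4 = 65/256.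
        ≤⟨ +-mono-≤ (*-mono 0≤X (nonNegative⁻¹ (+ 1 / 16)) X≤ X≤) (*-mono 0≤X (nonNegative⁻¹ (+ 4 / 1)) X≤ x*x*s≤4) ⟩
      + 65 / 256 ∎
    Z≤½ : Z ≤ ½
    Z≤½ = begin
      Z ≡⟨ *-identityʳ Z ⟨
      -- As r ≥ 3/4, the factor r · 4/3 is at least 1; it supplies the r that `k * t` lacks for
      -- `[1-ε]^≤^⁴` at the full exponent. The outcome is 65/192.
      Z * 1ℚ ≤⟨ *-monoˡ 0≤Z 1≤ ⟩
      Z * (r * (+ 4 / 3))
        ≡⟨ solve 4 (λ r t k c → (r :* t :+ k :* t) :* (r :* c) := c :* (r :* t :* (r :+ k))) refl r t k (+ 4 / 3) ⟩
      (+ 4 / 3) * (r * t * (r + k))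
        ≤⟨ *-monoˡ (nonNegative⁻¹ (+ 4 / 3)) (≤-trans (*-monoˡ 0≤rt (+-monoˡ-≤ k r≤1)) rt[1+k]≤) ⟩
      (+ 4 / 3) * (+ 65 / 256) ≤⟨ toWitness {a? = (+ 4 / 3) * (+ 65 / 256) ≤? ½} _ ⟩
      ½ ∎
      where
      r≤1 : r ≤ 1ℚ
      r≤1 = ≤-byDiff ε 0≤ε (solve 1 (λ ε → con 1ℚ :- ε :+ ε := con 1ℚ) refl ε)
      1≤ : 1ℚ ≤ r * (+ 4 / 3)
      1≤ = *-monoʳ {a = 1ℚ - ¼} {b = r} (nonNegative⁻¹ (+ 4 / 3)) (+-monoʳ-≤ 1ℚ (neg-antimono-≤ ε≤¼))

  -- For s = 0 the power x is 1, against x ≤ 1/4. Hence samples are nonempty and the exponent s - 1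
  -- makes sense.
  ¬SizeBound-0 : ∀ ε → 0ℚ < ε → ε ≤ ¼ → ¬ SizeBound ε 0
  ¬SizeBound-0 ε 0<ε ε≤¼ size with toWitness {a? = ¼ <? 1ℚ} _
  ... | ¼<1 = <-irrefl refl (<-≤-trans ¼<1 (SizeBound-consequences.x≤¼ ε 0<ε ε≤¼ 0 size))

  sumFin-≤ : ∀ m (f : Fin m → ℕ) t → (∀ i → ⟦ f i ⟧ ≤ t) → ⟦ sumFin m f ⟧ ≤ ⟦ m ⟧ * t
  sumFin-≤ zero    f t f≤t = ≤-reflexive (sym (*-zeroˡ t))
  sumFin-≤ (suc m) f t f≤t = begin
    ⟦ f zero ℕ.+ S ⟧   ≡⟨ ⟦⟧-homo-+ (f zero) S ⟩
    ⟦ f zero ⟧ + ⟦ S ⟧ ≤⟨ +-mono-≤ (f≤t zero) (sumFin-≤ m (λ i → f (suc i)) t (λ i → f≤t (suc i))) ⟩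
    t + ⟦ m ⟧ * t      ≡⟨ solve 2 (λ t m → t :+ m :* t := (con 1ℚ :+ m) :* t) refl t ⟦ m ⟧ ⟩
    (1ℚ + ⟦ m ⟧) * t   ≡⟨ cong (_* t) (⟦⟧-homo-+ 1 m) ⟨
    ⟦ suc m ⟧ * t ∎
    where S = sumFin m (λ i → f (suc i))

  -- The union bound in numbers: `b C suc s` will count the samples missing the conflicts of `l₀`,
  -- and `f i` those that contain i and miss the conflicts of i. `C-ratio` bounds each, and
  -- absorption makes both contributions multiples of `M`.
  failures-≤-half : ∀ ε → 0ℚ < ε → ε ≤ ¼ → ∀ s → SizeBound ε (suc s) →
    ∀ m d → ε * ⟦ suc m ⟧ ≤ ⟦ d ⟧ →
    ∀ b → b ℕ.+ d ℕ.≤ suc m →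
    (f : Fin (suc m) → ℕ) → (∀ i → ∃ λ c → c ℕ.+ d ℕ.≤ m × f i ℕ.≤ c C s) →
    2 ℕ.* (b C suc s ℕ.+ sumFin (suc m) f) ℕ.≤ suc m C suc s
  failures-≤-half ε 0<ε ε≤¼ s size m d εm≤d b b+d≤m f f≤ =
    ⟦⟧-cancel {2 ℕ.* F} {suc m C suc s} (begin
      ⟦ 2 ℕ.* F ⟧ ≡⟨ ⟦⟧-homo-* 2 F ⟩
      (+ 2 / 1) * ⟦ F ⟧ ≤⟨ *-monoˡ (nonNegative⁻¹ (+ 2 / 1)) F≤ ⟩
      (+ 2 / 1) * (M * Z) ≡⟨ solve 2 (λ M Z → con (+ 2 / 1) :* (M :* Z) := M :* (Z :+ Z)) refl M Z ⟩
      M * (Z + Z) ≤⟨ *-monoˡ (0≤⟦⟧ (suc m C suc s)) (failure-weight ε 0<ε ε≤¼ s size) ⟩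
      M * 1ℚ ≡⟨ *-identityʳ M ⟩
      M ∎)
    where
    open SizeBound-consequences ε 0<ε ε≤¼ (suc s) size using (0≤1-ε; 0≤ε)
    F = b C suc s ℕ.+ sumFin (suc m) f
    M = ⟦ suc m C suc s ⟧
    r = 1ℚ - ε
    Z = r ^ suc s + ⟦ suc s ⟧ * r ^ s
    εm'≤d : ε * ⟦ m ⟧ ≤ ⟦ d ⟧
    εm'≤d = ≤-trans (*-monoˡ 0≤ε (⟦⟧-mono {m} {suc m} (ℕₚ.n≤1+n m))) εm≤d
    f≤′ : ∀ i → ⟦ f i ⟧ ≤ r ^ s * ⟦ m C s ⟧
    f≤′ i = let c , c+d≤m , fi≤ = f≤ i in
      ≤-trans (⟦⟧-mono {f i} {c C s} fi≤) (C-ratio {b = c} {m = m} 0≤1-ε 0≤ε c+d≤m εm'≤d s)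
    F≤ : ⟦ F ⟧ ≤ M * Z
    F≤ = begin
      ⟦ F ⟧ ≡⟨ ⟦⟧-homo-+ (b C suc s) (sumFin (suc m) f) ⟩
      ⟦ b C suc s ⟧ + ⟦ sumFin (suc m) f ⟧
        ≤⟨ +-mono-≤ (C-ratio {b = b} {m = suc m} 0≤1-ε 0≤ε b+d≤m εm≤d (suc s)) (sumFin-≤ (suc m) f _ f≤′) ⟩
      r ^ suc s * M + ⟦ suc m ⟧ * (r ^ s * ⟦ m C s ⟧)
        ≡⟨ solve 4 (λ A m t c → A :+ m :* (t :* c) := A :+ (m :* c) :* t) refl (r ^ suc s * M) ⟦ suc m ⟧ (r ^ s) ⟦ m C s ⟧ ⟩
      r ^ suc s * M + ⟦ suc m ⟧ * ⟦ m C s ⟧ * r ^ s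
        ≡⟨ cong (λ z → r ^ suc s * M + z * r ^ s) (trans (sym (⟦⟧-homo-* (suc m) (m C s)))
             (trans (cong ⟦_⟧ (sym ([k+1]*[n+1]C[k+1] m s))) (⟦⟧-homo-* (suc s) (suc m C suc s)))) ⟩
      r ^ suc s * M + ⟦ suc s ⟧ * M * r ^ s
        ≡⟨ solve 4 (λ A M k t → A :* M :+ k :* M :* t := M :* (A :+ k :* t)) refl (r ^ suc s) M ⟦ suc s ⟧ (r ^ s) ⟩
      M * Z ∎

open RationalEstimates
open import Data.Nat using (_+_; _*_; _≤_; z≤n; s≤s; _<ᵇ_; _≤?_; _≟_)
open import Data.Nat.Properties
open import Data.Rational using (ℚ; 0ℚ; _<_) renaming (_≤_ to _≤ℚ_; _*_ to _*ℚ_)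

-- Finite sums and counting

sumFin-cong : ∀ m {f g : Fin m → ℕ} → (∀ i → f i ≡ g i) → sumFin m f ≡ sumFin m g
sumFin-cong zero    f≡g = refl
sumFin-cong (suc m) f≡g = cong₂ _+_ (f≡g zero) (sumFin-cong m (f≡g ∘ suc))

sumFin-mono : ∀ m {f g : Fin m → ℕ} → (∀ i → f i ≤ g i) → sumFin m f ≤ sumFin m g
sumFin-mono zero    f≤g = z≤n
sumFin-mono (suc m) f≤g = +-mono-≤ (f≤g zero) (sumFin-mono m (f≤g ∘ suc))

sumFin-zero : ∀ m → sumFin m (λ _ → 0) ≡ 0
sumFin-zero zero    = refl
sumFin-zero (suc m) = sumFin-zero m

sumFin-one : ∀ m → sumFin m (λ _ → 1) ≡ m
sumFin-one zero    = refl
sumFin-one (suc m) = cong suc (sumFin-one m)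

sumFin-+ : ∀ m (f g : Fin m → ℕ) → sumFin m (λ i → f i + g i) ≡ sumFin m f + sumFin m g
sumFin-+ zero    f g = refl
sumFin-+ (suc m) f g = trans (cong (f zero + g zero +_) (sumFin-+ m (f ∘ suc) (g ∘ suc)))
  (interchange (f zero) (g zero) (sumFin m (f ∘ suc)) (sumFin m (g ∘ suc)))

sumFin-*ʳ : ∀ m (f : Fin m → ℕ) c → sumFin m (λ i → f i * c) ≡ sumFin m f * c
sumFin-*ʳ zero    f c = refl
sumFin-*ʳ (suc m) f c = trans (cong (f zero * c +_) (sumFin-*ʳ m (f ∘ suc) c))
  (sym (*-distribʳ-+ c (f zero) (sumFin m (f ∘ suc))))

bit : Bool → ℕ
bit true  = 1
bit false = 0

count : ∀ {m} → (Fin m → Bool) → ℕ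
count {m} p = sumFin m (bit ∘ p)

_==_ : ∀ {m} → Fin m → Fin m → Bool
x == i = does (x Finₚ.≟ i)

==-refl : ∀ {m} (x : Fin m) → (x == x) ≡ true
==-refl x = dec-true (x Finₚ.≟ x) refl

sumFin-== : ∀ {m} (x : Fin m) (f : Fin m → ℕ) → sumFin m (λ i → bit (x == i) * f i) ≡ f x
sumFin-== {suc m} zero    f = trans (cong (f zero + 0 +_) (sumFin-zero m)) (trans (+-identityʳ _) (+-identityʳ _))
sumFin-== {suc m} (suc x) f = sumFin-== x (f ∘ suc)

bit≤1 : ∀ b → bit b ≤ 1
bit≤1 true  = s≤s z≤n
bit≤1 false = z≤n

count≤m : ∀ {m} (p : Fin m → Bool) → count p ≤ m
count≤m {m} p = ≤-trans (sumFin-mono m (λ i → bit≤1 (p i))) (≤-reflexive (sumFin-one m))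

count-complement : ∀ {m} (p : Fin m → Bool) → count (not ∘ p) + count p ≡ m
count-complement {m} p = trans (sym (sumFin-+ m _ _)) (trans (sumFin-cong m (λ i → bit-not (p i))) (sumFin-one m))
  where
  bit-not : ∀ b → bit (not b) + bit b ≡ 1
  bit-not true  = refl
  bit-not false = refl

-- The indicator of x can be added to p without exceeding q. This measures progress twice: peeling
-- shrinks the vertex set, and climbing enlarges a neighbourhood.
count-strict : ∀ {m} {p q : Fin m → Bool} x → p x ≡ false → q x ≡ true →
  (∀ i → p i ≡ true → q i ≡ true) → suc (count p) ≤ count q
count-strict {m} {p} {q} x px qx p⇒q = begin
  suc (count p) ≡⟨ cong (_+ count p) (sym (sumFin-== x (λ _ → 1))) ⟩
  sumFin m (λ i → bit (x == i) * 1) + count p ≡⟨ sumFin-+ m _ _ ⟨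
  sumFin m (λ i → bit (x == i) * 1 + bit (p i)) ≤⟨ sumFin-mono m step ⟩
  count q ∎
  where
  open ≤-Reasoning
  step : ∀ i → bit (x == i) * 1 + bit (p i) ≤ bit (q i)
  step i with x Finₚ.≟ i
  ... | yes refl rewrite px | qx = ≤-refl
  ... | no _ with p i in eq
  ...   | false = z≤n
  ...   | true rewrite p⇒q i eq = ≤-refl

count-inhabited : ∀ {m} {p : Fin m → Bool} x → p x ≡ true → ∃ λ c → count p ≡ suc c
count-inhabited {suc m} {p} zero    px rewrite px = _ , refl
count-inhabited {suc m} {p} (suc x) px =
  let c , eq = count-inhabited {p = p ∘ suc} x px in
  bit (p zero) + c , trans (cong (bit (p zero) +_) eq) (+-suc _ c)

true≢false : ∀ {b} → b ≡ true → b ≡ false → ⊥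
true≢false refl ()

∧-true : ∀ {a b} → a ∧ b ≡ true → a ≡ true × b ≡ true
∧-true {true} {true} _ = refl , refl

-- With the larger number written as the smaller plus c, the two sides differ by c².
4ab≤[a+b]² : ∀ a b → 4 * (a * b) ≤ (a + b) * (a + b)
4ab≤[a+b]² a b with ≤-total a b
... | inj₁ a≤b with m≤n⇒∃[o]m+o≡n a≤b
...   | c , refl = ≤-trans (m≤m+n _ (c * c)) (≤-reflexive
  (solve 2 (λ a c → con 4 :* (a :* (a :+ c)) :+ c :* c := (a :+ (a :+ c)) :* (a :+ (a :+ c))) refl a c))
  where open ℕ-Solver using (solve; _:=_; _:+_; _:*_; con)
4ab≤[a+b]² a b | inj₂ b≤a with m≤n⇒∃[o]m+o≡n b≤a
...   | c , refl = ≤-trans (m≤m+n _ (c * c)) (≤-reflexive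
  (solve 2 (λ b c → con 4 :* ((b :+ c) :* b) :+ c :* c := (b :+ c :+ b) :* (b :+ c :+ b)) refl b c))
  where open ℕ-Solver using (solve; _:=_; _:+_; _:*_; con)

-- At most |L| · |R| pairs change, and |L| + |R| = m.
dist-empty : ∀ {m} (side : Side m) (E : Fin m → Fin m → Bool) → 4 * dist side E (λ _ _ → false) ≤ m * m
dist-empty {m} side E = begin
  4 * dist side E (λ _ _ → false) ≤⟨ *-monoʳ-≤ 4 (sumFin-mono m λ i → sumFin-mono m λ j → bound i j) ⟩
  4 * sumFin m (λ i → sumFin m (λ j → bit (not (side i)) * bit (side j)))
    ≡⟨ cong (4 *_) (sumFin-cong m (λ i → trans (sumFin-cong m (λ j → *-comm (bit (not (side i))) (bit (side j))))
         (trans (sumFin-*ʳ m (bit ∘ side) (bit (not (side i)))) (*-comm (count side) _)))) ⟩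
  4 * sumFin m (λ i → bit (not (side i)) * count side)
    ≡⟨ cong (4 *_) (sumFin-*ʳ m _ (count side)) ⟩
  4 * (count (not ∘ side) * count side) ≤⟨ 4ab≤[a+b]² (count (not ∘ side)) (count side) ⟩
  (count (not ∘ side) + count side) * (count (not ∘ side) + count side)
    ≡⟨ cong₂ _*_ (count-complement side) (count-complement side) ⟩
  m * m ∎
  where
  open ≤-Reasoning
  bound : ∀ i j → pairLR (side i) (side j) * differ (E i j) false ≤ bit (not (side i)) * bit (side j)
  bound i j with side i | side j | E i j
  ... | true  | _     | _     = z≤n
  ... | false | false | _     = z≤n
  ... | false | true  | true  = ≤-refl
  ... | false | true  | false = z≤n

-- Peeling

module Peeling {m} (side : Side m) (E : Fin m → Fin m → Bool) (E-sym : ∀ i j → E i j ≡ E j i) where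

  -- Whether the pair of a vertex on side a and a vertex on side b, joined or not according to e, must change when
  -- the first vertex is made complete (if in L) or isolated (if in R).
  conflict : (a b e : Bool) → Bool
  conflict false true  e = not e
  conflict true  false e = e
  conflict _     _     _ = false

  conflicts : (Fin m → Bool) → Fin m → Fin m → Bool
  conflicts S x y = S y ∧ conflict (side x) (side y) (E x y)

  conflict-irrefl : ∀ a e → conflict a a e ≡ false
  conflict-irrefl true  e = refl
  conflict-irrefl false e = refl

  conflicts-irrefl : ∀ S x → conflicts S x x ≡ false
  conflicts-irrefl S x = trans (cong (S x ∧_) (conflict-irrefl (side x) (E x x))) (Boolₚ.∧-zeroʳ (S x))

  -- `dense` covers both sides at once, since `conflicts` picks non-neighbours for x in L and
  -- neighbours for x in R.
  record Core (d : ℕ) : Set where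
    field
      S     : Fin m → Bool
      l₀    : Fin m
      l₀∈S  : S l₀ ≡ true
      l₀∈L  : side l₀ ≡ false
      dense : ∀ x → S x ≡ true → d ≤ count (conflicts S x)

  -- Peeling the vertices in the order of pos leaves ℓ complete to the later r and r isolated from the later ℓ.
  threshold : (Fin m → ℕ) → Fin m → Fin m → Bool
  threshold pos l r = pos l <ᵇ pos r

  -- An M₂ would close the cycle pos l₁ < pos r₁ ≤ pos l₂ < pos r₂ ≤ pos l₁.
  threshold-M₂Free : ∀ pos → M₂Free side (threshold pos)
  threshold-M₂Free pos (l₁ , l₂ , r₁ , r₂ , _ , _ , _ , _ , _ , _ , _ , _ , _ , _ , e₁₁ , e₂₂ , e₁₂ , e₂₁) =
    <-irrefl refl (<-≤-trans (less l₁ r₁ e₁₁) (≤-trans (geq l₂ r₁ e₂₁)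
      (≤-trans (<⇒≤ (less l₂ r₂ e₂₂)) (geq l₁ r₂ e₁₂))))
    where
    less : ∀ l r → threshold pos l r ≡ true → pos l ℕ.< pos r
    less l r eq = <ᵇ⇒< (pos l) (pos r) (subst Bool.T (sym eq) tt)
    geq : ∀ l r → threshold pos l r ≡ false → pos r ≤ pos l
    geq l r eq = ≮⇒≥ (λ lt → subst Bool.T eq (<⇒<ᵇ lt))

  pairCost : (S : Fin m → Bool) (pos : Fin m → ℕ) → Fin m → Fin m → ℕ
  pairCost S pos i j = bit (S i) * (bit (S j) * (pairLR (side i) (side j) * differ (E i j) (threshold pos i j)))

  cost : (S : Fin m → Bool) (pos : Fin m → ℕ) → ℕ
  cost S pos = sumFin m λ i → sumFin m λ j → pairCost S pos i j

  remove : Fin m → (Fin m → Bool) → Fin m → Bool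
  remove x S i = not (x == i) ∧ S i

  -- Moving all other vertices back by one keeps their mutual comparisons, even definitionally, so
  -- pairs without x cost what they did before.
  first : Fin m → (Fin m → ℕ) → Fin m → ℕ
  first x pos i = if x == i then 0 else suc (pos i)

  -- In front of all others, x is joined to every r, so a pair (x, r) is paid for exactly when it
  -- conflicts. Pairs (i, x) are free, because x is not in R.
  pairCost-firstL : ∀ S pos x → side x ≡ false → ∀ i j →
    pairCost S (first x pos) i j ≤ pairCost (remove x S) pos i j + bit (x == i) * bit (conflicts S x j)
  pairCost-firstL S pos x x∈L i j with x Finₚ.≟ i
  ... | yes refl with x Finₚ.≟ j
  ...   | yes refl rewrite x∈L | *-zeroʳ (bit (S x)) | *-zeroʳ (bit (S x)) = z≤n
  ...   | no _ rewrite x∈L with S x | S j | side j | E x j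
  ...     | false | _     | _     | _     = z≤n
  ...     | true  | false | _     | _     = z≤n
  ...     | true  | true  | false | _     = z≤n
  ...     | true  | true  | true  | true  = z≤n
  ...     | true  | true  | true  | false = ≤-refl
  pairCost-firstL S pos x x∈L i j | no _ with x Finₚ.≟ j
  ...   | no _ = m≤m+n _ _
  ...   | yes refl rewrite x∈L with side i | S i | S x
  ...     | true  | true  | true  = z≤n
  ...     | true  | true  | false = z≤n
  ...     | true  | false | _     = z≤n
  ...     | false | true  | true  = z≤n
  ...     | false | true  | false = z≤n
  ...     | false | false | _     = z≤n

  -- Dually, nothing precedes x, so x is isolated and a pair (l, x) is paid for exactly when it is
  -- an edge. Symmetry of `E` reconciles the order of the two ends in `dist` and in `conflicts`.
  pairCost-firstR : ∀ S pos x → side x ≡ true → ∀ i j →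
    pairCost S (first x pos) i j ≤ pairCost (remove x S) pos i j + bit (conflicts S x i) * bit (x == j)
  pairCost-firstR S pos x x∈R i j with x Finₚ.≟ j
  ... | yes refl rewrite x∈R | E-sym x i with x Finₚ.≟ i
  ...   | yes refl rewrite x∈R with S x
  ...     | true  = z≤n
  ...     | false = z≤n
  pairCost-firstR S pos x x∈R i j | yes refl | no _ with S i | S x | side i | E i x
  ...     | false | _     | _     | _     = z≤n
  ...     | true  | false | _     | _     = z≤n
  ...     | true  | true  | true  | _     = z≤n
  ...     | true  | true  | false | true  = ≤-refl
  ...     | true  | true  | false | false = z≤n
  pairCost-firstR S pos x x∈R i j | no _ with x Finₚ.≟ i
  ...   | no _ = m≤m+n _ _
  ...   | yes refl rewrite x∈R with S x | S j
  ...     | true  | true  = z≤n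
  ...     | true  | false = z≤n
  ...     | false | _     = z≤n

  -- The extra payments fill the row of x if x is in L and its column if x is in R; either one sums
  -- to the number of conflicts of x.
  cost-first : ∀ S pos x b → side x ≡ b → cost S (first x pos) ≤ cost (remove x S) pos + count (conflicts S x)
  cost-first S pos x false eq = begin
    cost S (first x pos)
      ≤⟨ sumFin-mono m (λ i → sumFin-mono m (pairCost-firstL S pos x eq i)) ⟩
    (sumFin m λ i → sumFin m λ j → pairCost (remove x S) pos i j + bit (x == i) * u j)
      ≡⟨ sumFin-cong m (λ i → sumFin-+ m _ _) ⟩
    (sumFin m λ i → sumFin m (pairCost (remove x S) pos i) + sumFin m λ j → bit (x == i) * u j)
      ≡⟨ sumFin-+ m _ _ ⟩
    cost (remove x S) pos + (sumFin m λ i → sumFin m λ j → bit (x == i) * u j)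
      ≡⟨ cong (cost (remove x S) pos +_) (sumFin-cong m (λ i → sumFin-*ˡ (bit (x == i)))) ⟩
    cost (remove x S) pos + (sumFin m λ i → bit (x == i) * sumFin m u)
      ≡⟨ cong (cost (remove x S) pos +_) (sumFin-== x (λ _ → sumFin m u)) ⟩
    cost (remove x S) pos + sumFin m u ∎
    where
    open ≤-Reasoning
    u : Fin m → ℕ
    u = bit ∘ conflicts S x
    sumFin-*ˡ : ∀ c → sumFin m (λ j → c * u j) ≡ c * sumFin m u
    sumFin-*ˡ c = trans (sumFin-cong m (λ j → *-comm c (u j))) (trans (sumFin-*ʳ m u c) (*-comm (sumFin m u) c))
  cost-first S pos x true eq = begin
    cost S (first x pos)
      ≤⟨ sumFin-mono m (λ i → sumFin-mono m (pairCost-firstR S pos x eq i)) ⟩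
    (sumFin m λ i → sumFin m λ j → pairCost (remove x S) pos i j + u i * bit (x == j))
      ≡⟨ sumFin-cong m (λ i → sumFin-+ m _ _) ⟩
    (sumFin m λ i → sumFin m (pairCost (remove x S) pos i) + sumFin m λ j → u i * bit (x == j))
      ≡⟨ sumFin-+ m _ _ ⟩
    cost (remove x S) pos + (sumFin m λ i → sumFin m λ j → u i * bit (x == j))
      ≡⟨ cong (cost (remove x S) pos +_) (sumFin-cong m (λ i →
           trans (sumFin-cong m (λ j → *-comm (u i) (bit (x == j)))) (sumFin-== x (λ _ → u i)))) ⟩
    cost (remove x S) pos + sumFin m u ∎
    where
    open ≤-Reasoning
    u : Fin m → ℕ
    u = bit ∘ conflicts S x

  count-remove : ∀ S x → S x ≡ true → suc (count (remove x S)) ≤ count S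
  count-remove S x x∈S = count-strict x (cong (λ b → not b ∧ S x) (==-refl x)) x∈S (λ i → proj₂ ∘ ∧-true {not (x == i)})

  cost-noL : ∀ S → (∀ x → S x ≡ true → side x ≡ true) → cost S (λ _ → 0) ≡ 0
  cost-noL S S⊆R = trans (sumFin-cong m (λ i → trans (sumFin-cong m (zeroCost i)) (sumFin-zero m))) (sumFin-zero m)
    where
    zeroCost : ∀ i j → pairCost S (λ _ → 0) i j ≡ 0
    zeroCost i j with S i in eq
    ... | false = refl
    ... | true rewrite S⊆R i eq with S j
    ...   | true  = refl
    ...   | false = refl

  -- f bounds the number of vertices left, so it is both the fuel and the number of payments of at
  -- most k. Once every vertex left has more than k conflicts, S is a core if it still meets L;
  -- otherwise no pair is left to pay for.
  peel : ∀ k f S → count S ≤ f → Core (suc k) ⊎ ∃ λ pos → cost S pos ≤ f * k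
  peel k f S |S|≤f
    with Finₚ.any? (λ x → (S x Boolₚ.≟ true) ×-dec (count (conflicts S x) ≤? k))
  peel k zero S |S|≤f | yes (x , x∈S , _) = contradiction (≤-trans (count-remove S x x∈S) |S|≤f) λ ()
  peel k (suc f) S |S|≤f | yes (x , x∈S , few)
    with peel k f (remove x S) (≤-pred (≤-trans (count-remove S x x∈S) |S|≤f))
  ... | inj₁ core = inj₁ core
  ... | inj₂ (pos , le) = inj₂ (first x pos ,
    ≤-trans (cost-first S pos x (side x) refl) (≤-trans (+-mono-≤ le few) (≤-reflexive (+-comm (f * k) k))))
  peel k f S |S|≤f | no none
    with Finₚ.any? (λ x → (S x Boolₚ.≟ true) ×-dec (side x Boolₚ.≟ false))
  ... | yes (l₀ , l₀∈S , l₀∈L) = inj₁ record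
    { S = S ; l₀ = l₀ ; l₀∈S = l₀∈S ; l₀∈L = l₀∈L
    ; dense = λ x x∈S → ≰⇒> (λ few → none (x , x∈S , few)) }
  ... | no noL = inj₂ ((λ _ → 0) , ≤-trans (≤-reflexive (cost-noL S S⊆R)) z≤n)
    where
    S⊆R : ∀ x → S x ≡ true → side x ≡ true
    S⊆R x x∈S with side x in eq
    ... | true  = refl
    ... | false = ⊥-elim (noL (x , x∈S , eq))

  core-or-close : ∀ k → Core (suc k) ⊎ ∃ λ H → M₂Free side H × dist side E H ≤ m * k
  core-or-close k with peel k m (λ _ → true) (count≤m (λ _ → true))
  ... | inj₁ core = inj₁ core
  ... | inj₂ (pos , le) = inj₂ (threshold pos , threshold-M₂Free pos , ≤-trans (≤-reflexive
    (sumFin-cong m λ i → sumFin-cong m λ j → sym (trans (+-identityʳ _) (+-identityʳ _)))) le)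

  -- From a core to an M₂ in the sample

  module _ {d} (core : Core d) (X : Subset m) where
    open Core core

    HitsConflicts : Fin m → Set
    HitsConflicts x = ∃ λ y → lookup X y ≡ true × conflicts S x y ≡ true

    conflictsL : ∀ {x y} → side x ≡ false → conflicts S x y ≡ true → S y ≡ true × side y ≡ true × E x y ≡ false
    conflictsL {x} {y} x∈L c rewrite x∈L with S y | side y | E x y
    ... | true | true | false = refl , refl , refl

    conflictsR : ∀ {x y} → side x ≡ true → conflicts S x y ≡ true → S y ≡ true × side y ≡ false × E x y ≡ true
    conflictsR {x} {y} x∈R c rewrite x∈R with S y | side y | E x y
    ... | true | false | true = refl , refl , refl

    module _ (hits : ∀ x → S x ≡ true → lookup X x ≡ true → HitsConflicts x) where

      nbrs : Fin m → Fin m → Bool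
      nbrs l r = lookup X r ∧ (side r ∧ E l r)

      -- As long as no M₂ shows up, ℓ₁ can be replaced by some ℓ₂ with a strictly larger neighbourhood in R ∩ X.
      climb : ∀ f l₁ → S l₁ ≡ true → side l₁ ≡ false → lookup X l₁ ≡ true →
        m ≤ f + count (nbrs l₁) → HasM₂ side X E
      climb f l₁ l₁∈S l₁∈L l₁∈X fuel
        with r₂ , r₂∈X , c₁ ← hits l₁ l₁∈S l₁∈X
        with r₂∈S , r₂∈R , e₁₂ ← conflictsL {l₁} {r₂} l₁∈L c₁
        with l₂ , l₂∈X , c₂ ← hits r₂ r₂∈S r₂∈X
        with l₂∈S , l₂∈L , e₂₂′ ← conflictsR {r₂} {l₂} r₂∈R c₂
        with e₂₂ ← trans (E-sym l₂ r₂) e₂₂′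
        with Finₚ.any? (λ r₁ → (nbrs l₁ r₁ Boolₚ.≟ true) ×-dec (E l₂ r₁ Boolₚ.≟ false))
      ... | yes (r₁ , r₁∈N , e₂₁) =
        let r₁∈X , r = ∧-true {lookup X r₁} r₁∈N ; r₁∈R , e₁₁ = ∧-true {side r₁} r in
        l₁ , l₂ , r₁ , r₂ ,
        (λ eq → true≢false e₂₂ (subst (λ l → E l r₂ ≡ false) eq e₁₂)) ,
        (λ eq → true≢false e₁₁ (subst (λ r → E l₁ r ≡ false) (sym eq) e₁₂)) ,
        l₁∈L , l₂∈L , r₁∈R , r₂∈R ,
        lookup⇒[]= l₁ X l₁∈X , lookup⇒[]= l₂ X l₂∈X , lookup⇒[]= r₁ X r₁∈X , lookup⇒[]= r₂ X r₂∈X ,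
        e₁₁ , e₂₂ , e₁₂ , e₂₁
      ... | no none = continue f fuel
        where
        -- Since no r₁ was found, every sampled neighbour of l₁ is one of l₂, and r₂ is a new one.
        larger : suc (count (nbrs l₁)) ≤ count (nbrs l₂)
        larger = count-strict r₂
          (cong₂ _∧_ r₂∈X (cong₂ _∧_ r₂∈R e₁₂)) (cong₂ _∧_ r₂∈X (cong₂ _∧_ r₂∈R e₂₂)) sub
          where
          sub : ∀ r → nbrs l₁ r ≡ true → nbrs l₂ r ≡ true
          sub r r∈N = let r∈X , r' = ∧-true {lookup X r} r∈N ; r∈R , _ = ∧-true {side r} r' in
            cong₂ _∧_ r∈X (cong₂ _∧_ r∈R (Boolₚ.¬-not (λ e → none (r , r∈N , e))))
        -- Each move takes one from f and adds at least one to the neighbourhood; at f = 0 the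
        -- neighbourhood of l₂ would have more than m vertices.
        continue : ∀ f → m ≤ f + count (nbrs l₁) → HasM₂ side X E
        continue zero    fuel = contradiction (≤-trans larger (≤-trans (count≤m (nbrs l₂)) fuel)) (<-irrefl refl)
        continue (suc f) fuel = climb f l₂ l₂∈S l₂∈L l₂∈X
          (≤-trans fuel (≤-trans (≤-reflexive (sym (+-suc f _))) (+-monoʳ-≤ f larger)))

      -- `l₀` may lie outside X. Two steps lead from it to a start for the climb: a conflict r in X,
      -- which is in the core, and a conflict l of r, which is in L, in the core and in X.
      hits⇒HasM₂ : HitsConflicts l₀ → HasM₂ side X E
      hits⇒HasM₂ (r , r∈X , c₀)
        with r∈S , r∈R , _ ← conflictsL {l₀} {r} l₀∈L c₀
        with l , l∈X , c ← hits r r∈S r∈X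
        with l∈S , l∈L , _ ← conflictsR {r} {l} r∈R c
        = climb m l l∈S l∈L l∈X (m≤m+n m _)

-- Counting bad samples

-- Uniform probability becomes counting in this duplicate-free list. It branches as Pascal's rule
-- does, so that totals over it follow the recursion of binomial coefficients.
subsets : (m s : ℕ) → List (Subset m)
subsets zero    zero    = [] ∷ []
subsets zero    (suc s) = []
subsets (suc m) zero    = map (outside ∷_) (subsets m zero)
subsets (suc m) (suc s) = map (inside ∷_) (subsets m s) ++ map (outside ∷_) (subsets m (suc s))

subsets-size : ∀ m s → All (λ X → ∣ X ∣ ≡ s) (subsets m s)
subsets-size zero    zero    = refl ∷ []
subsets-size zero    (suc s) = []
subsets-size (suc m) zero    = Allₚ.map⁺ (subsets-size m zero)
subsets-size (suc m) (suc s) =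
  Allₚ.++⁺ (Allₚ.map⁺ (All.map (cong suc) (subsets-size m s))) (Allₚ.map⁺ (subsets-size m (suc s)))

subsets-unique : ∀ m s → Unique (subsets m s)
subsets-unique zero    zero    = [] ∷ []
subsets-unique zero    (suc s) = []
subsets-unique (suc m) zero    = Uniqueₚ.map⁺ ∷-injectiveʳ (subsets-unique m zero)
subsets-unique (suc m) (suc s) = Uniqueₚ.++⁺
  (Uniqueₚ.map⁺ ∷-injectiveʳ (subsets-unique m s)) (Uniqueₚ.map⁺ ∷-injectiveʳ (subsets-unique m (suc s)))
  λ (p , q) → clash (proj₂ (proj₂ (∈-map⁻ (inside ∷_) p))) (proj₂ (proj₂ (∈-map⁻ (outside ∷_) q)))
  where
  clash : ∀ {X : Subset (suc m)} {Y Z} → X ≡ inside ∷ Y → X ≡ outside ∷ Z → ⊥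
  clash refl ()

length-subsets : ∀ m s → length (subsets m s) ≡ m C s
length-subsets zero    zero    = refl
length-subsets zero    (suc s) = refl
length-subsets (suc m) zero    =
  trans (Listₚ.length-map _ (subsets m zero)) (trans (length-subsets m zero) (trans (nC0≡1 m) (sym (nC0≡1 (suc m)))))
length-subsets (suc m) (suc s) = trans (Listₚ.length-++ (map (inside ∷_) (subsets m s)))
  (trans (cong₂ _+_ (trans (Listₚ.length-map _ (subsets m s)) (length-subsets m s))
                    (trans (Listₚ.length-map _ (subsets m (suc s))) (length-subsets m (suc s))))
    (nCk+nC[k+1]≡[n+1]C[k+1] m s))

total : ∀ {A : Set} → (A → ℕ) → List A → ℕ
total f xs = sum (map f xs)

module _ {A : Set} where

  total-map : ∀ {B : Set} (f : B → ℕ) (g : A → B) xs → total f (map g xs) ≡ total (f ∘ g) xs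
  total-map f g xs = cong sum (sym (Listₚ.map-∘ xs))

  total-++ : ∀ (f : A → ℕ) xs ys → total f (xs ++ ys) ≡ total f xs + total f ys
  total-++ f xs ys = trans (cong sum (Listₚ.map-++ f xs ys)) (sum-++ (map f xs) (map f ys))

  total-cong : ∀ {f g : A → ℕ} → (∀ x → f x ≡ g x) → ∀ xs → total f xs ≡ total g xs
  total-cong f≡g xs = cong sum (Listₚ.map-cong f≡g xs)

  total-zero : ∀ {f : A → ℕ} → (∀ x → f x ≡ 0) → ∀ xs → total f xs ≡ 0
  total-zero f≡0 []       = refl
  total-zero f≡0 (x ∷ xs) = cong₂ _+_ (f≡0 x) (total-zero f≡0 xs)

  total-+ : ∀ (f g : A → ℕ) xs → total (λ x → f x + g x) xs ≡ total f xs + total g xs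
  total-+ f g []       = refl
  total-+ f g (x ∷ xs) = trans (cong (f x + g x +_) (total-+ f g xs))
    (interchange (f x) (g x) (total f xs) (total g xs))

  total-sumFin : ∀ m (f : Fin m → A → ℕ) xs →
    total (λ x → sumFin m (λ i → f i x)) xs ≡ sumFin m (λ i → total (f i) xs)
  total-sumFin zero    f xs = total-zero (λ _ → refl) xs
  total-sumFin (suc m) f xs =
    trans (total-+ (f zero) (λ x → sumFin m (λ i → f (suc i) x)) xs) (cong (total (f zero) xs +_) (total-sumFin m (f ∘ suc) xs))

  -- The first-moment bound: an entry dropped by the filter has weight at least 1.
  length≤filter+total : ∀ (f : A → ℕ) xs → length xs ≤ length (filter (λ x → f x ≟ 0) xs) + total f xs
  length≤filter+total f []       = z≤n
  length≤filter+total f (x ∷ xs) with f x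
  ... | zero  = s≤s (length≤filter+total f xs)
  ... | suc k = let n = length (filter (λ x → f x ≟ 0) xs) in
    ≤-trans (s≤s (≤-trans (length≤filter+total f xs) (+-monoʳ-≤ n (m≤n+m (total f xs) k))))
      (≤-reflexive (sym (+-suc n (k + total f xs))))

total-subsets : ∀ {m} (f : Subset (suc m) → ℕ) s →
  total f (subsets (suc m) (suc s)) ≡ total (f ∘ (inside ∷_)) (subsets m s) + total (f ∘ (outside ∷_)) (subsets m (suc s))
total-subsets {m} f s = trans (total-++ f (map (inside ∷_) (subsets m s)) _)
  (cong₂ _+_ (total-map f (inside ∷_) (subsets m s)) (total-map f (outside ∷_) (subsets m (suc s))))

avoids : ∀ {m} → (Fin m → Bool) → Subset m → Bool
avoids T []      = true
avoids T (b ∷ X) = not (b ∧ T zero) ∧ avoids (T ∘ suc) X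

¬avoids : ∀ {m} (T : Fin m → Bool) X → avoids T X ≡ false → ∃ λ y → lookup X y ≡ true × T y ≡ true
¬avoids T (true ∷ X) eq with T zero in T0
... | true  = zero , refl , T0
... | false = let y , y∈X , Ty = ¬avoids (T ∘ suc) X eq in suc y , y∈X , Ty
¬avoids T (false ∷ X) eq = let y , y∈X , Ty = ¬avoids (T ∘ suc) X eq in suc y , y∈X , Ty

-- The samples counted are the s-subsets of the complement of T: a first vertex in T must stay out,
-- any other one is a case of Pascal's rule.
total-avoids : ∀ {m} (T : Fin m → Bool) s → total (bit ∘ avoids T) (subsets m s) ≡ count (not ∘ T) C s
total-avoids {zero}  T zero    = refl
total-avoids {zero}  T (suc s) = refl
total-avoids {suc m} T zero    = trans (total-map (bit ∘ avoids T) (outside ∷_) (subsets m zero))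
  (trans (total-avoids (T ∘ suc) zero) (trans (nC0≡1 (count (not ∘ T ∘ suc))) (sym (nC0≡1 (count (not ∘ T))))))
total-avoids {suc m} T (suc s) = trans (total-subsets (bit ∘ avoids T) s) step
  where
  step : total (bit ∘ avoids T ∘ (inside ∷_)) (subsets m s) + total (bit ∘ avoids (T ∘ suc)) (subsets m (suc s))
       ≡ count (not ∘ T) C suc s
  step with T zero
  ... | true  = cong₂ _+_ (total-zero (λ _ → refl) (subsets m s)) (total-avoids (T ∘ suc) (suc s))
  ... | false = trans (cong₂ _+_ (total-avoids (T ∘ suc) s) (total-avoids (T ∘ suc) (suc s)))
    (nCk+nC[k+1]≡[n+1]C[k+1] (count (not ∘ T ∘ suc)) s)

contains-avoids : ∀ {m} → Fin m → (Fin m → Bool) → Subset m → Bool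
contains-avoids x T X = lookup X x ∧ avoids T X

total-contains-avoids-0 : ∀ {m} x (T : Fin m → Bool) → total (bit ∘ contains-avoids x T) (subsets m 0) ≡ 0
total-contains-avoids-0 {suc m} zero    T = trans (total-map _ (outside ∷_) (subsets m 0)) (total-zero (λ _ → refl) (subsets m 0))
total-contains-avoids-0 {suc m} (suc x) T = trans (total-map _ (outside ∷_) (subsets m 0)) (total-contains-avoids-0 x (T ∘ suc))

-- x is forced into the sample, and the other s elements come from the c further vertices outside T.
total-contains-avoids : ∀ {m} x (T : Fin m → Bool) → T x ≡ false → ∀ c → count (not ∘ T) ≡ suc c → ∀ s →
  total (bit ∘ contains-avoids x T) (subsets m (suc s)) ≡ c C s
total-contains-avoids {suc m} zero T T0 c eq s =
  trans (total-subsets (bit ∘ contains-avoids zero T) s)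
    (trans (cong₂ _+_
      (trans (total-cong (λ X → cong (λ t → bit (not t ∧ avoids (T ∘ suc) X)) T0) (subsets m s)) (total-avoids (T ∘ suc) s))
      (total-zero (λ _ → refl) (subsets m (suc s))))
    (trans (+-identityʳ _) (cong (_C s) (suc-injective (trans (cong (λ t → bit (not t) + count (not ∘ T ∘ suc)) (sym T0)) eq)))))
total-contains-avoids {suc m} (suc x) T Tx c eq s =
  trans (total-subsets (bit ∘ contains-avoids (suc x) T) s) (step (T zero) eq)
  where
  step : ∀ t → bit (not t) + count (not ∘ T ∘ suc) ≡ suc c →
    total (λ X → bit (lookup X x ∧ (not t ∧ avoids (T ∘ suc) X))) (subsets m s)
      + total (bit ∘ contains-avoids x (T ∘ suc)) (subsets m (suc s)) ≡ c C s
  step true  eq = cong₂ _+_ (total-zero (λ X → cong bit (Boolₚ.∧-zeroʳ (lookup X x))) (subsets m s))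
    (total-contains-avoids x (T ∘ suc) Tx c eq s)
  -- The tail contains x, which is outside T, so c is a successor and Pascal's rule applies to it.
  step false eq with count-inhabited {p = not ∘ T ∘ suc} x (cong not Tx)
  ... | c′ , eq′ with trans (sym eq′) (suc-injective eq)
  ...   | refl = trans (cong (total (bit ∘ contains-avoids x (T ∘ suc)) (subsets m s) +_)
                   (total-contains-avoids x (T ∘ suc) Tx c′ eq′ s)) (pascal s)
    where
    pascal : ∀ s → total (bit ∘ contains-avoids x (T ∘ suc)) (subsets m s) + c′ C s ≡ suc c′ C s
    pascal zero    = trans (cong₂ _+_ (total-contains-avoids-0 x (T ∘ suc)) (nC0≡1 c′)) (sym (nC0≡1 (suc c′)))
    pascal (suc s) = trans (cong (_+ c′ C suc s) (total-contains-avoids x (T ∘ suc) Tx c′ eq′ s))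
      (nCk+nC[k+1]≡[n+1]C[k+1] c′ s)

count-avoiders : ∀ {m d} x (T : Fin (suc m) → Bool) → T x ≡ false → d ≤ count T → ∃ λ c →
  c + d ≤ m × count (not ∘ T) ≡ suc c
count-avoiders {m} {d} x T Tx d≤ =
  let c , eq = count-inhabited {p = not ∘ T} x (cong not Tx) in
  c , ≤-pred (≤-trans (+-monoʳ-≤ (suc c) d≤)
        (≤-reflexive (trans (cong (_+ count T) (sym eq)) (count-complement T)))) , eq

-- The union bound over a core

module _ {m} (side : Side (suc m)) (E : Fin (suc m) → Fin (suc m) → Bool) (E-sym : ∀ i j → E i j ≡ E j i)
         {d} (core : Peeling.Core side E E-sym d) where

  open Peeling side E E-sym
  open Core core

  missed : Fin (suc m) → Subset (suc m) → ℕ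
  missed x X = bit (S x ∧ contains-avoids x (conflicts S x) X)

  -- The number of requirements that X violates; its total over all samples is the quantity of the
  -- union bound.
  failures : Subset (suc m) → ℕ
  failures X = bit (avoids (conflicts S l₀) X) + sumFin (suc m) (λ x → missed x X)

  bit≡0 : ∀ {b} → bit b ≡ 0 → b ≡ false
  bit≡0 {false} _ = refl

  sumFin≡0 : ∀ n (f : Fin n → ℕ) → sumFin n f ≡ 0 → ∀ i → f i ≡ 0
  sumFin≡0 (suc n) f eq zero    = m+n≡0⇒m≡0 (f zero) eq
  sumFin≡0 (suc n) f eq (suc i) = sumFin≡0 n (f ∘ suc) (m+n≡0⇒n≡0 (f zero) eq) i

  no-failures⇒HasM₂ : ∀ X → failures X ≡ 0 → HasM₂ side X E
  no-failures⇒HasM₂ X eq = hits⇒HasM₂ core X hits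
    (¬avoids (conflicts S l₀) X (bit≡0 (m+n≡0⇒m≡0 _ eq)))
    where
    hits : ∀ x → S x ≡ true → lookup X x ≡ true → HitsConflicts core X x
    hits x x∈S x∈X = ¬avoids (conflicts S x) X (trans (sym (cong₂ (λ a b → a ∧ (b ∧ avoids (conflicts S x) X)) x∈S x∈X))
      (bit≡0 (sumFin≡0 (suc m) (λ x → missed x X) (m+n≡0⇒n≡0 (bit (avoids (conflicts S l₀) X)) eq) x)))

  missed-bound : ∀ s x → ∃ λ c → c + d ≤ m × total (missed x) (subsets (suc m) (suc s)) ≤ c C s
  missed-bound s x with S x in eq
  -- Outside the core nothing can be missed, so any admissible c will do; `l₀` provides one.
  ... | false = let c , c+d≤m , _ = count-avoiders l₀ (conflicts S l₀) (conflicts-irrefl S l₀) (dense l₀ l₀∈S) in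
    c , c+d≤m , ≤-trans (≤-reflexive (total-zero (λ _ → refl) (subsets (suc m) (suc s)))) z≤n
  ... | true = let c , c+d≤m , eq′ = count-avoiders x (conflicts S x) (conflicts-irrefl S x) (dense x eq) in
    c , c+d≤m , ≤-reflexive (total-contains-avoids x (conflicts S x) (conflicts-irrefl S x) c eq′ s)

  core⇒many-M₂ : ∀ ε → 0ℚ < ε → ε ≤ℚ ¼ → ε *ℚ ⟦ suc m ⟧ ≤ℚ ⟦ d ⟧ → ∀ s → SizeBound ε (suc s) →
    ∃ λ (Xs : List (Subset (suc m))) → Unique Xs ×
      All (λ X → (∣ X ∣ ≡ suc s) × HasM₂ side X E) Xs × (suc m C suc s) ≤ 2 * length Xs
  core⇒many-M₂ ε 0<ε ε≤¼ εm≤d s size =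
    Xs , Uniqueₚ.filter⁺ _ (subsets-unique (suc m) (suc s)) ,
    All.zip (Allₚ.filter⁺ _ (subsets-size (suc m) (suc s)) ,
             All.map (λ {X} → no-failures⇒HasM₂ X) (Allₚ.all-filter (λ X → failures X ≟ 0) all)) ,
    -- Twice the failures are at most `N`, so one `N` cancels from 2N ≤ 2 · good + 2 · failures.
    +-cancelʳ-≤ N N (2 * length Xs) (begin
      N + N ≡⟨ cong (N +_) (+-identityʳ N) ⟨
      2 * N ≡⟨ cong (2 *_) (length-subsets (suc m) (suc s)) ⟨
      2 * length all ≤⟨ *-monoʳ-≤ 2 (length≤filter+total failures all) ⟩
      2 * (length Xs + total failures all) ≡⟨ *-distribˡ-+ 2 (length Xs) _ ⟩
      2 * length Xs + 2 * total failures all ≡⟨ cong (λ z → 2 * length Xs + 2 * z) total-failures ⟩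
      2 * length Xs + 2 * (b C suc s + sumFin (suc m) (λ x → total (missed x) all))
        ≤⟨ +-monoʳ-≤ (2 * length Xs) (failures-≤-half ε 0<ε ε≤¼ s size m d εm≤d b b+d≤m _ (missed-bound s)) ⟩
      2 * length Xs + N ∎)
    where
    open ≤-Reasoning
    N = suc m C suc s
    all = subsets (suc m) (suc s)
    Xs = filter (λ X → failures X ≟ 0) all
    b = count (not ∘ conflicts S l₀)
    b+d≤m : b + d ≤ suc m
    b+d≤m = ≤-trans (+-monoʳ-≤ b (dense l₀ l₀∈S)) (≤-reflexive (count-complement (conflicts S l₀)))
    total-failures : total failures all ≡ b C suc s + sumFin (suc m) (λ x → total (missed x) all)
    total-failures = trans (total-+ _ _ all)
      (cong₂ _+_ (total-avoids (conflicts S l₀) (suc s)) (total-sumFin (suc m) missed all))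

-- From distance to a core

-- For x = εn, the strict lower bound puts the peeling cost mk below εn², while the upper bound
-- gives the core its density k + 1 ≥ εn.
ceiling : ∀ {x} → 0ℚ < x → ∀ N → x ≤ℚ ⟦ N ⟧ → ∃ λ k → ⟦ k ⟧ < x × x ≤ℚ ⟦ suc k ⟧
ceiling 0<x zero    x≤N = ⊥-elim (ℚₚ.<-irrefl refl (ℚₚ.<-≤-trans 0<x x≤N))
ceiling {x} 0<x (suc N) x≤N with x ℚ.≤? ⟦ N ⟧
... | yes x≤N′ = ceiling 0<x N x≤N′
... | no  x≰N′ = N , ℚₚ.≰⇒> x≰N′ , x≤N

Far : ∀ {m} → ℚ → ℕ → Side m → (Fin m → Fin m → Bool) → Set
Far ε n side E = ∀ H → M₂Free side H → ε *ℚ ⟦ n * n ⟧ ≤ℚ ⟦ dist side E H ⟧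

-- Tested against the empty bipartite graph, `Far` yields εn² ≤ m²/4 ≤ n²/4.
far⇒ε≤¼ : ∀ ε n {m} → 1 ≤ n → m ≤ n → (side : Side m) (E : Fin m → Fin m → Bool) → Far ε n side E → ε ≤ℚ ¼
far⇒ε≤¼ ε n {m} 1≤n m≤n side E far = ℚₚ.*-cancelʳ-≤-pos ⟦ n * n ⟧ {{⟦⟧-positive (*-mono-≤ 1≤n 1≤n)}} (begin
  ε *ℚ ⟦ n * n ⟧ ≤⟨ far (λ _ _ → false) (λ { (_ , _ , _ , _ , _ , _ , _ , _ , _ , _ , _ , _ , _ , _ , () , _) }) ⟩
  ⟦ D ⟧           ≡⟨ ℚₚ.*-identityˡ ⟦ D ⟧ ⟨
  ¼ *ℚ ⟦ 4 ⟧ *ℚ ⟦ D ⟧ ≡⟨ ℚₚ.*-assoc ¼ ⟦ 4 ⟧ ⟦ D ⟧ ⟩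
  ¼ *ℚ (⟦ 4 ⟧ *ℚ ⟦ D ⟧) ≡⟨ cong (¼ *ℚ_) (⟦⟧-homo-* 4 D) ⟨
  ¼ *ℚ ⟦ 4 * D ⟧
    ≤⟨ *-monoˡ (ℚₚ.nonNegative⁻¹ ¼) (⟦⟧-mono {4 * D} {n * n} (≤-trans (dist-empty side E) (*-mono-≤ m≤n m≤n))) ⟩
  ¼ *ℚ ⟦ n * n ⟧ ∎)
  where
  open ℚₚ.≤-Reasoning
  D = dist side E (λ _ _ → false)

far⇒core : ∀ ε n {m} → 0ℚ < ε → 1 ≤ n → m ≤ n →
  (side : Side m) (E : Fin m → Fin m → Bool) (E-sym : ∀ i j → E i j ≡ E j i) → Far ε n side E →
  ∃ λ d → ε *ℚ ⟦ n ⟧ ≤ℚ ⟦ d ⟧ × Peeling.Core side E E-sym d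
far⇒core ε n {m} 0<ε 1≤n m≤n side E E-sym far = round-up (ceiling 0<εn n εn≤n)
  where
  open ℚₚ.≤-Reasoning

  εn : ℚ
  εn = ε *ℚ ⟦ n ⟧

  0<εn : 0ℚ < εn
  0<εn = ℚₚ.positive⁻¹ εn {{ℚₚ.pos*pos⇒pos ε {{ℚ.positive 0<ε}} ⟦ n ⟧ {{⟦⟧-positive 1≤n}}}}

  εn≤n : εn ≤ℚ ⟦ n ⟧
  εn≤n = subst (εn ≤ℚ_) (ℚₚ.*-identityˡ ⟦ n ⟧)
    (*-monoʳ (0≤⟦⟧ n) (ℚₚ.≤-trans (far⇒ε≤¼ ε n 1≤n m≤n side E far) (toWitness {a? = ¼ ℚ.≤? ℚ.1ℚ} _)))

  -- The peeled graph would be at distance at most mk ≤ nk < n · εn.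
  not-close : ∀ k → ⟦ k ⟧ < εn → ∀ H → M₂Free side H → dist side E H ≤ m * k → ⊥
  not-close k k<εn H H-free close = ℚₚ.<-irrefl refl (begin-strict
    ε *ℚ ⟦ n * n ⟧ ≤⟨ far H H-free ⟩
    ⟦ dist side E H ⟧ ≤⟨ ⟦⟧-mono {dist side E H} {n * k} (≤-trans close (*-monoˡ-≤ k m≤n)) ⟩
    ⟦ n * k ⟧ ≡⟨ ⟦⟧-homo-* n k ⟩
    ⟦ n ⟧ *ℚ ⟦ k ⟧ <⟨ ℚₚ.*-monoʳ-<-pos ⟦ n ⟧ {{⟦⟧-positive 1≤n}} k<εn ⟩
    ⟦ n ⟧ *ℚ εn ≡⟨ ℚₚ.*-comm ⟦ n ⟧ εn ⟩
    εn *ℚ ⟦ n ⟧ ≡⟨ ℚₚ.*-assoc ε ⟦ n ⟧ ⟦ n ⟧ ⟩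
    ε *ℚ (⟦ n ⟧ *ℚ ⟦ n ⟧) ≡⟨ cong (ε *ℚ_) (⟦⟧-homo-* n n) ⟨
    ε *ℚ ⟦ n * n ⟧ ∎)

  choose : ∀ k → ⟦ k ⟧ < εn → Peeling.Core side E E-sym (suc k) ⊎ (∃ λ H → M₂Free side H × dist side E H ≤ m * k) →
    Peeling.Core side E E-sym (suc k)
  choose k k<εn (inj₁ core)                   = core
  choose k k<εn (inj₂ (H , H-free , close)) = ⊥-elim (not-close k k<εn H H-free close)

  round-up : (∃ λ k → ⟦ k ⟧ < εn × εn ≤ℚ ⟦ suc k ⟧) → ∃ λ d → εn ≤ℚ ⟦ d ⟧ × Peeling.Core side E E-sym d
  round-up (k , k<εn , εn≤k+1) = suc k , εn≤k+1 , choose k k<εn (Peeling.core-or-close side E E-sym k)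

theorem6 : (ε : ℚ) → 0ℚ < ε → (n m : ℕ) → 1 ≤ n → m ≤ n →
    (G : Graph m) (side : Side m) →
    ((H : _) → M₂Free side H →
      ε *ℚ ⟦ n * n ⟧ ≤ℚ ⟦ dist side (Graph.adj G) H ⟧) →
    (s : ℕ) → SizeBound ε s →
    ∃ λ (Xs : List (Subset m)) → Unique Xs ×
      All (λ X → (∣ X ∣ ≡ s) × HasM₂ side X (Graph.adj G)) Xs ×
      (m C s) ≤ 2 * length Xs
theorem6 ε 0<ε n m 1≤n m≤n G side far s size =
  sample m m≤n adj-sym s size (far⇒core ε n 0<ε 1≤n m≤n side adj adj-sym far)
  where
  open Graph G renaming (sym to adj-sym)

  ε≤¼ : ε ≤ℚ ¼
  ε≤¼ = far⇒ε≤¼ ε n 1≤n m≤n side adj far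

  -- Stated for all m and s so that both can be split: a core has a vertex, which excludes m = 0,
  -- and the size bound excludes s = 0.
  sample : ∀ m → m ≤ n → {side : Side m} {E : Fin m → Fin m → Bool} (E-sym : ∀ i j → E i j ≡ E j i) →
    ∀ s → SizeBound ε s → (∃ λ d → ε *ℚ ⟦ n ⟧ ≤ℚ ⟦ d ⟧ × Peeling.Core side E E-sym d) →
    ∃ λ (Xs : List (Subset m)) → Unique Xs ×
      All (λ X → (∣ X ∣ ≡ s) × HasM₂ side X E) Xs × (m C s) ≤ 2 * length Xs
  sample zero    _   E-sym _       _    (_ , _ , record { l₀ = () })
  sample (suc m) m≤n E-sym zero    size _ = ⊥-elim (¬SizeBound-0 ε 0<ε ε≤¼ size)
  sample (suc m) m≤n E-sym (suc s) size (d , εn≤d , core) = core⇒many-M₂ _ _ E-sym core ε 0<ε ε≤¼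
    (ℚₚ.≤-trans (*-monoˡ (ℚₚ.<⇒≤ 0<ε) (⟦⟧-mono {suc m} {n} m≤n)) εn≤d) s size
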